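{- Let $d\geq 2$ and $n$ be integers with $n\equiv -1\pmod d$ and $n\geq 2d-1$. Then \[ \frac{(q^d;q^d)_{n-1}^d}{(1-q)^{dn-d}}\sum_{k=0}^{n-1}\frac{(q^{d+1};q^d)_k^{d-2}(q;q^d)_k(q^{1-d};q^d)_k\,q^{dk}}{(q^d;q^d)_k^d}\equiv 0\pmod{[n]^2}, \] where $[n]=1+q+\cdots+q^{n-1}$.
   Context: For a complex variable $x$ and integer $m\ge 0$, $(x;q)_m=(1-x)(1-xq)\cdots(1-xq^{m-1})$, with $(x;q)_0=1$; $(x;q)_m^e$ denotes its $e$-th power. For rational functions $A(q),B(q)$ and a polynomial $P(q)$, $A\equiv B\pmod{P(q)}$ means that $(A-B)/P$ is a rational function whose denominator is coprime to $P(q)$. -}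

module Defs where

open import Data.Nat as ℕ using (ℕ; zero; suc)
open import Data.Integer as ℤ using (ℤ; +_; -[1+_])
open import Data.List using (List; []; _∷_; replicate)
open import Data.Product using (Σ; ∃; _×_; _,_)
open import Relation.Binary.PropositionalEquality using (_≡_)
open import Relation.Nullary using (¬_)

-- Polynomials in q with integer coefficients: coefficient lists,
-- the i-th entry being the coefficient of q^i.

Poly : Set
Poly = List ℤ

coeff : Poly → ℕ → ℤ
coeff []       _       = + 0
coeff (a ∷ _)  zero    = a
coeff (_ ∷ as) (suc i) = coeff as i

-- semantic equality of polynomials (trailing zeros irrelevant)
_≈P_ : Poly → Poly → Set
p ≈P r = ∀ i → coeff p i ≡ coeff r i

infix 4 _≈P_ _≈F_

_+P_ : Poly → Poly → Poly
[]       +P r        = r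
(a ∷ as) +P []       = a ∷ as
(a ∷ as) +P (b ∷ bs) = (a ℤ.+ b) ∷ (as +P bs)

scaleP : ℤ → Poly → Poly
scaleP c []       = []
scaleP c (a ∷ as) = (c ℤ.* a) ∷ scaleP c as

negP : Poly → Poly
negP = scaleP (ℤ.- (+ 1))

_*P_ : Poly → Poly → Poly
[]       *P r = []
(a ∷ as) *P r = scaleP a r +P (+ 0 ∷ (as *P r))

constP : ℤ → Poly
constP c = c ∷ []

monoP : ℕ → Poly
monoP zero    = + 1 ∷ []
monoP (suc m) = + 0 ∷ monoP m

qInt : ℕ → Poly
qInt n = replicate n (+ 1)

-- Coprimality of polynomials (in ℚ[q]), via Bézout with denominators cleared:
-- U·D + V·P is a nonzero integer constant.
Coprime : Poly → Poly → Set
Coprime D P = Σ Poly λ U → Σ Poly λ V → Σ ℤ λ c →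
  ¬ (c ≡ + 0) × ((U *P D) +P (V *P P) ≈P constP c)

record Frac : Set where
  constructor _⁄_
  field
    num : Poly
    den : Poly
open Frac public

_≈F_ : Frac → Frac → Set
a ≈F b = num a *P den b ≈P num b *P den a

poly : Poly → Frac
poly p = p ⁄ constP (+ 1)

_+F_ : Frac → Frac → Frac
a +F b = ((num a *P den b) +P (num b *P den a)) ⁄ (den a *P den b)

-F_ : Frac → Frac
-F a = negP (num a) ⁄ den a

_-F_ : Frac → Frac → Frac
a -F b = a +F (-F b)

_*F_ : Frac → Frac → Frac
a *F b = (num a *P num b) ⁄ (den a *P den b)

_/F_ : Frac → Frac → Frac
a /F b = (num a *P den b) ⁄ (den a *P num b)

_^F_ : Frac → ℕ → Frac
a ^F zero  = poly (constP (+ 1))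
a ^F suc m = (a ^F m) *F a

infixl 6 _+F_ _-F_
infixl 7 _*F_ _/F_
infixr 8 _^F_

oneF zeroF : Frac
oneF  = poly (constP (+ 1))
zeroF = poly []

qPow : ℤ → Frac
qPow (+ m)    = poly (monoP m)
qPow -[1+ m ] = oneF /F poly (monoP (suc m))

qF : Frac
qF = qPow (+ 1)

poch : Frac → Frac → ℕ → Frac
poch x b zero    = oneF
poch x b (suc m) = poch x b m *F (oneF -F x *F b ^F m)

sumF : ℕ → (ℕ → Frac) → Frac
sumF zero    f = zeroF
sumF (suc n) f = sumF n f +F f n

CongMod : Frac → Frac → Poly → Set
CongMod A B P = Σ Poly λ N → Σ Poly λ D →
  Coprime D P × (A -F B ≈F poly P *F (N ⁄ D))

summand : ℕ → ℕ → Frac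
summand d k =
  (poch (qPow (+ (d ℕ.+ 1))) (qPow (+ d)) k ^F (d ℕ.∸ 2)
    *F poch qF (qPow (+ d)) k
    *F poch (qPow (+ 1 ℤ.- + d)) (qPow (+ d)) k
    *F qPow (+ (d ℕ.* k)))
  /F (poch (qPow (+ d)) (qPow (+ d)) k ^F d)

lhs : ℕ → ℕ → Frac
lhs d n =
  (poch (qPow (+ d)) (qPow (+ d)) (n ℕ.∸ 1) ^F d
     /F (oneF -F qF) ^F (d ℕ.* n ℕ.∸ d))
  *F sumF n (summand d)

{-# OPTIONS --safe #-}

-- Write Q = q^d, n = dm − 1, M = n − 1, u = q^n.  Multiplied by (Q;Q)_M^d, the sum is
--   G = Σ_k (qQ;Q)_k^{d−2} (q;Q)_k (q/Q;Q)_k (Q^{k+1};Q)_{M−k}^d Q^k,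
-- and it suffices that (1 − u)² divides 2G, because 1 − u = (1 − q)[n] and 2, q and
-- 1 − q are coprime to [n].  So compute modulo (u − 1)², where u^j and u^{−j} are
-- 1 ± ε with ε² = 0.  To first order, d − 1 of the d factors (Q·Q^k;Q)_{M−k} may be
-- replaced by d − 2 copies with Q/u and one with Q u^{d−2} in place of the first Q,
-- and 2 (q;Q)_k (q/Q;Q)_k may be replaced by the symmetric sum over the sign of
-- (q u^{±(d−1)};Q)_k (q u^{∓(d−1)}/Q;Q)_k.  Since q = Q^m/u, in both resulting sums
-- one numerator parameter is Q^{−N} and every other one is a power of Q times a
-- denominator parameter; the exponents of these powers add up to less than N, so both
-- sums vanish by the q-Karlsson–Minton identity.
module Submission where

open import Defs
open import Algebra.Bundles using (CommutativeRing)
import Algebra.Properties.AbelianGroup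
import Algebra.Properties.CommutativeSemiring.Exp
import Algebra.Properties.Ring
import Algebra.Properties.Semiring.Mult.TCOptimised
import Algebra.Solver.Ring
open import Algebra.Solver.Ring.AlmostCommutativeRing using (fromCommutativeRing; _-Raw-AlmostCommutative⟶_)
open import Data.Empty using (⊥-elim)
open import Data.Fin.Base using (zero; suc)
open import Data.Integer as ℤ using (ℤ; +_; -[1+_])
import Data.Integer.Properties as ℤ
open import Data.Integer.Solver using () renaming (module +-*-Solver to ℤ-Solver)
open import Data.List.Base using ([]; _∷_)
open import Data.Maybe.Base using (Maybe; just; nothing)
open import Data.Nat as ℕ using (ℕ; zero; suc; _∸_; _≤_; _<_; z≤n; s≤s)
open import Data.Nat.Divisibility using (_∣_; divides)
import Data.Nat.Properties as ℕ
open import Data.Nat.Solver using (module +-*-Solver)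
open import Data.Product using (∃; _,_; proj₁; proj₂)
open import Data.Sign as Sign using (Sign)
open import Data.Sum using (inj₁; inj₂)
open import Data.Vec.Base using (_∷_; [])
open import Function.Base using (_∘_)
open import Level using (Level; 0ℓ)
open import Relation.Binary.PropositionalEquality as ≡ using (_≡_; _≢_)
import Relation.Binary.Reasoning.Setoid
open import Relation.Nullary using (yes; no)

-- The obstacle is division. The denominators 1 - Q^k share factors such as 1 - q with 1 - u, so
-- they are not invertible modulo (1 - u)^2 and must be cleared before reducing. Only q keeps an
-- inverse, because u (2 - u) = 1 - (u - 1)^2. Hence the q-series part is division-free, holds in
-- any commutative ring, and is then applied to a quotient of ℤ[q]. The perturbations come from q u
-- = q^(n+1) = Q^m. In the block of d - 1 equal factors the exponents of u, namely -1 taken d - 2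
-- times and d - 2 once, add up to zero, so the first-order terms cancel at once. The parameters q
-- and q/Q have different first-order terms, so for them only the mean of two opposite perturbations
-- is correct; this is the origin of the 2. The exponent d - 1 is chosen because (q/Q) u^(-(d-1)) =
-- (q u)^(-(d-1)) is a power of Q, and q u^(d-1) = Q^m u^(d-2) explains the parameter Q u^(d-2). In
-- both halves the degree is exactly N - 1.

-- Ring solver with integer coefficients over an arbitrary commutative ring

module IntegerCoefficients {c ℓ : Level} (R : CommutativeRing c ℓ) where
  open CommutativeRing R
  open Algebra.Properties.Ring ring
  open Algebra.Properties.AbelianGroup +-abelianGroup using (⁻¹-∙-comm; ⁻¹-involutive; ε⁻¹≈ε)
  open Algebra.Properties.Semiring.Mult.TCOptimised semiring using (×-homo-+; ×1-homo-*; 1+×) renaming (_×_ to _·_)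
  open Relation.Binary.Reasoning.Setoid setoid

  ⟦_⟧ : ℤ → Carrier
  ⟦ + n ⟧      = n · 1#
  ⟦ -[1+ n ] ⟧ = - (suc n · 1#)

  neg-homo : ∀ i → ⟦ ℤ.- i ⟧ ≈ - ⟦ i ⟧
  neg-homo (+ zero)  = sym ε⁻¹≈ε
  neg-homo (+ suc n) = refl
  neg-homo -[1+ n ]  = sym (⁻¹-involutive _)

  cancel-common : ∀ z x y → x - y ≈ (z + x) - (z + y)
  cancel-common z x y = sym (begin
    (z + x) - (z + y)         ≈⟨ +-congˡ (⁻¹-∙-comm z y) ⟨
    (z + x) + (- z - y)       ≈⟨ +-congʳ (+-comm z x) ⟩
    (x + z) + (- z - y)       ≈⟨ +-assoc x z _ ⟩
    x + (z + (- z - y))       ≈⟨ +-congˡ (+-assoc z (- z) (- y)) ⟨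
    x + ((z - z) - y)         ≈⟨ +-congˡ (+-congʳ (-‿inverseʳ z)) ⟩
    x + (0# - y)              ≈⟨ +-congˡ (+-identityˡ _) ⟩
    x - y                     ∎)

  ⊖-homo : ∀ m n → ⟦ m ℤ.⊖ n ⟧ ≈ m · 1# - n · 1#
  ⊖-homo zero    zero    = sym (-‿inverseʳ 0#)
  ⊖-homo zero    (suc n) = sym (+-identityˡ _)
  ⊖-homo (suc m) zero    = sym (trans (+-congˡ ε⁻¹≈ε) (+-identityʳ _))
  ⊖-homo (suc m) (suc n) = begin
    ⟦ suc m ℤ.⊖ suc n ⟧     ≡⟨ ≡.cong ⟦_⟧ (ℤ.[1+m]⊖[1+n]≡m⊖n m n) ⟩
    ⟦ m ℤ.⊖ n ⟧             ≈⟨ ⊖-homo m n ⟩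
    m · 1# - n · 1#         ≈⟨ cancel-common 1# _ _ ⟩
    (1# + m · 1#) - (1# + n · 1#) ≈⟨ +-cong (1+× m 1#) (-‿cong (1+× n 1#)) ⟨
    suc m · 1# - suc n · 1# ∎

  +-homo : ∀ i j → ⟦ i ℤ.+ j ⟧ ≈ ⟦ i ⟧ + ⟦ j ⟧
  +-homo (+ m)    (+ n)    = ×-homo-+ 1# m n
  +-homo (+ m)    -[1+ n ] = ⊖-homo m (suc n)
  +-homo -[1+ m ] (+ n)    = trans (⊖-homo n (suc m)) (+-comm _ _)
  +-homo -[1+ m ] -[1+ n ] = begin
    - (suc (suc (m ℕ.+ n)) · 1#)      ≡⟨ ≡.cong (λ k → - (suc k · 1#)) (≡.sym (ℕ.+-suc m n)) ⟩
    - ((suc m ℕ.+ suc n) · 1#)        ≈⟨ -‿cong (×-homo-+ 1# (suc m) (suc n)) ⟩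
    - (suc m · 1# + suc n · 1#)       ≈⟨ ⁻¹-∙-comm _ _ ⟨
    - (suc m · 1#) - (suc n · 1#)     ∎

  +◃-homo : ∀ n → ⟦ Sign.+ ℤ.◃ n ⟧ ≈ n · 1#
  +◃-homo n = reflexive (≡.cong ⟦_⟧ (ℤ.+◃n≡+n n))

  -◃-homo : ∀ n → ⟦ Sign.- ℤ.◃ n ⟧ ≈ - (n · 1#)
  -◃-homo n = trans (reflexive (≡.cong ⟦_⟧ (ℤ.-◃n≡-n n))) (neg-homo (+ n))

  *-homo : ∀ i j → ⟦ i ℤ.* j ⟧ ≈ ⟦ i ⟧ * ⟦ j ⟧
  *-homo (+ m)    (+ n)    = trans (+◃-homo (m ℕ.* n)) (×1-homo-* m n)
  *-homo (+ m)    -[1+ n ] = trans (-◃-homo (m ℕ.* suc n))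
    (trans (-‿cong (×1-homo-* m (suc n))) (-‿distribʳ-* _ _))
  *-homo -[1+ m ] (+ n)    = trans (-◃-homo (suc m ℕ.* n))
    (trans (-‿cong (×1-homo-* (suc m) n)) (-‿distribˡ-* _ _))
  *-homo -[1+ m ] -[1+ n ] = begin
    ⟦ Sign.+ ℤ.◃ (suc m ℕ.* suc n) ⟧  ≈⟨ +◃-homo (suc m ℕ.* suc n) ⟩
    (suc m ℕ.* suc n) · 1#            ≈⟨ ×1-homo-* (suc m) (suc n) ⟩
    (suc m · 1#) * (suc n · 1#)       ≈⟨ ⁻¹-involutive _ ⟨
    - - ((suc m · 1#) * (suc n · 1#)) ≈⟨ -‿cong (-‿distribʳ-* _ _) ⟩
    - ((suc m · 1#) * - (suc n · 1#)) ≈⟨ -‿distribˡ-* _ _ ⟩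
    ⟦ -[1+ m ] ⟧ * ⟦ -[1+ n ] ⟧       ∎

  morphism : ℤ.+-*-rawRing -Raw-AlmostCommutative⟶ fromCommutativeRing R
  morphism = record
    { ⟦_⟧    = ⟦_⟧
    ; +-homo = +-homo
    ; *-homo = *-homo
    ; -‿homo = neg-homo
    ; 0-homo = refl
    ; 1-homo = refl
    }

  -- Equality in R need not be decidable; the solver only has to compare integer coefficients, and
  -- equal integers have equal images.
  coefficient≟ : ∀ i j → Maybe (⟦ i ⟧ ≈ ⟦ j ⟧)
  coefficient≟ i j with i ℤ.≟ j
  ... | yes ≡.refl = just refl
  ... | no _       = nothing

  module Solver = Algebra.Solver.Ring ℤ.+-*-rawRing (fromCommutativeRing R) morphism coefficient≟

-- q-series in a commutative ring

module Sums {c ℓ : Level} (R : CommutativeRing c ℓ) where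
  open CommutativeRing R
  open IntegerCoefficients R using (module Solver)
  open Solver using (solve; _:=_; _:+_)

  sum : ℕ → (ℕ → Carrier) → Carrier
  sum zero    f = 0#
  sum (suc n) f = sum n f + f n

  sum-cong< : ∀ n {f g} → (∀ k → k < n → f k ≈ g k) → sum n f ≈ sum n g
  sum-cong< zero    h = refl
  sum-cong< (suc n) h =
    +-cong (sum-cong< n (λ k k<n → h k (ℕ.m<n⇒m<1+n k<n))) (h n ℕ.≤-refl)

  sum-+ : ∀ n f g → sum n (λ k → f k + g k) ≈ sum n f + sum n g
  sum-+ zero    f g = sym (+-identityˡ 0#)
  sum-+ (suc n) f g = trans (+-congʳ (sum-+ n f g))
    (solve 4 (λ a b x y → (a :+ b) :+ (x :+ y) := (a :+ x) :+ (b :+ y)) refl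
      (sum n f) (sum n g) (f n) (g n))

  sum-*ˡ : ∀ n a f → sum n (λ k → a * f k) ≈ a * sum n f
  sum-*ˡ zero    a f = sym (zeroʳ a)
  sum-*ˡ (suc n) a f = trans (+-congʳ (sum-*ˡ n a f)) (sym (distribˡ a _ _))

module Pochhammer {c ℓ : Level} (R : CommutativeRing c ℓ) (Q : CommutativeRing.Carrier R) where
  open CommutativeRing R
  open IntegerCoefficients R using (module Solver)
  open Solver using (solve; _:=_; _:+_; _:*_; _:-_; con)
  open Algebra.Properties.CommutativeSemiring.Exp commutativeSemiring
  open Relation.Binary.Reasoning.Setoid setoid
  open Sums R

  qpoch : Carrier → ℕ → Carrier
  qpoch x zero    = 1#
  qpoch x (suc k) = qpoch x k * (1# - x * Q ^ k)

  factor-cong : ∀ {x y b} → x ≈ y → 1# - x * b ≈ 1# - y * b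
  factor-cong x≈y = +-congˡ (-‿cong (*-congʳ x≈y))

  qpoch-cong : ∀ {x y} k → x ≈ y → qpoch x k ≈ qpoch y k
  qpoch-cong zero    x≈y = refl
  qpoch-cong (suc k) x≈y = *-cong (qpoch-cong k x≈y) (factor-cong x≈y)

  -- Y^k (X/Y;Q)_k, meaningful without inverting Y.
  homogeneous : Carrier → Carrier → ℕ → Carrier
  homogeneous X Y zero    = 1#
  homogeneous X Y (suc k) = homogeneous X Y k * (Y - X * Q ^ k)

  homogeneous-qpoch : ∀ {x X Y} → x * Y ≈ X → ∀ k → homogeneous X Y k ≈ Y ^ k * qpoch x k
  homogeneous-qpoch xY≈X zero = sym (*-identityˡ 1#)
  homogeneous-qpoch {x} {X} {Y} xY≈X (suc k) = begin
    homogeneous X Y k * (Y - X * Q ^ k)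
      ≈⟨ *-cong (homogeneous-qpoch xY≈X k) (+-congˡ (-‿cong (*-congʳ (sym xY≈X)))) ⟩
    Y ^ k * qpoch x k * (Y - x * Y * Q ^ k)
      ≈⟨ solve 5 (λ P f Y x b → P :* f :* (Y :- x :* Y :* b) := Y :* P :* (f :* (con (+ 1) :- x :* b)))
           refl (Y ^ k) (qpoch x k) Y x (Q ^ k) ⟩
    Y ^ suc k * qpoch x (suc k) ∎

  1^k≈1 : ∀ k → 1# ^ k ≈ 1#
  1^k≈1 zero    = refl
  1^k≈1 (suc k) = trans (*-identityˡ _) (1^k≈1 k)

  homogeneous-1 : ∀ x k → homogeneous x 1# k ≈ qpoch x k
  homogeneous-1 x k = trans (homogeneous-qpoch (*-identityʳ x) k)
    (trans (*-congʳ (1^k≈1 k)) (*-identityˡ _))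

  *-assoc-^ : ∀ x i j → (x * Q ^ i) * Q ^ j ≈ x * Q ^ (i ℕ.+ j)
  *-assoc-^ x i j = trans (*-assoc x _ _) (*-congˡ (sym (^-homo-* Q i j)))

  qpoch-+ : ∀ x i j → qpoch x (i ℕ.+ j) ≈ qpoch x i * qpoch (x * Q ^ i) j
  qpoch-+ x i zero = begin
    qpoch x (i ℕ.+ 0) ≡⟨ ≡.cong (qpoch x) (ℕ.+-identityʳ i) ⟩
    qpoch x i         ≈⟨ *-identityʳ _ ⟨
    qpoch x i * 1#    ∎
  qpoch-+ x i (suc j) = begin
    qpoch x (i ℕ.+ suc j)
      ≡⟨ ≡.cong (qpoch x) (ℕ.+-suc i j) ⟩
    qpoch x (i ℕ.+ j) * (1# - x * Q ^ (i ℕ.+ j))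
      ≈⟨ *-cong (qpoch-+ x i j) (+-congˡ (-‿cong (sym (*-assoc-^ x i j)))) ⟩
    (qpoch x i * qpoch (x * Q ^ i) j) * (1# - (x * Q ^ i) * Q ^ j)
      ≈⟨ *-assoc _ _ _ ⟩
    qpoch x i * qpoch (x * Q ^ i) (suc j) ∎

  qpoch-vanishes : ∀ x j k → j < k → x * Q ^ j ≈ 1# → qpoch x k ≈ 0#
  qpoch-vanishes x j (suc k) j<1+k xQʲ≈1 with j ℕ.≟ k
  ... | yes ≡.refl = trans (*-congˡ (trans (+-congˡ (-‿cong xQʲ≈1)) (-‿inverseʳ 1#))) (zeroʳ _)
  ... | no j≢k = trans (*-congʳ (qpoch-vanishes x j k (ℕ.≤∧≢⇒< (ℕ.s≤s⁻¹ j<1+k) j≢k) xQʲ≈1)) (zeroˡ _)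

  -- Both sides are products of 1 − b Q^i over the index ranges [m, m+k) ∪ [k, M)
  -- and [m, M) ∪ [k, k+m), which agree as multisets.
  qpoch-exchange : ∀ b m k M → m ≤ M → k ≤ M →
    qpoch (b * Q ^ m) k * qpoch (b * Q ^ k) (M ∸ k)
    ≈ qpoch (b * Q ^ m) (M ∸ m) * qpoch (b * Q ^ k) m
  qpoch-exchange b m k M m≤M k≤M with ℕ.≤-total (k ℕ.+ m) M
  ... | inj₁ k+m≤M = begin
    qpoch (b * Q ^ m) k * qpoch (b * Q ^ k) (M ∸ k)
      ≡⟨ ≡.cong (λ i → qpoch (b * Q ^ m) k * qpoch (b * Q ^ k) i) M∸k≡m+s ⟩
    qpoch (b * Q ^ m) k * qpoch (b * Q ^ k) (m ℕ.+ s)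
      ≈⟨ *-congˡ (qpoch-+ _ m s) ⟩
    qpoch (b * Q ^ m) k * (qpoch (b * Q ^ k) m * qpoch (b * Q ^ k * Q ^ m) s)
      ≈⟨ solve 3 (λ x y z → x :* (y :* z) := (x :* z) :* y) refl _ _ _ ⟩
    (qpoch (b * Q ^ m) k * qpoch (b * Q ^ k * Q ^ m) s) * qpoch (b * Q ^ k) m
      ≈⟨ *-congʳ (*-congˡ (qpoch-cong s
           (solve 3 (λ x y z → x :* y :* z := x :* z :* y) refl b (Q ^ k) (Q ^ m)))) ⟩
    (qpoch (b * Q ^ m) k * qpoch (b * Q ^ m * Q ^ k) s) * qpoch (b * Q ^ k) m
      ≈⟨ *-congʳ (qpoch-+ _ k s) ⟨
    qpoch (b * Q ^ m) (k ℕ.+ s) * qpoch (b * Q ^ k) m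
      ≡⟨ ≡.cong (λ i → qpoch (b * Q ^ m) i * qpoch (b * Q ^ k) m) M∸m≡k+s ⟨
    qpoch (b * Q ^ m) (M ∸ m) * qpoch (b * Q ^ k) m ∎
    where
    s = M ∸ (k ℕ.+ m)
    M∸k≡m+s : M ∸ k ≡ m ℕ.+ s
    M∸k≡m+s = ≡.trans (≡.cong (_∸ k)
      (≡.trans (≡.sym (ℕ.m+[n∸m]≡n k+m≤M)) (ℕ.+-assoc k m s))) (ℕ.m+n∸m≡n k _)
    M∸m≡k+s : M ∸ m ≡ k ℕ.+ s
    M∸m≡k+s = ≡.trans (≡.cong (_∸ m)
      (≡.trans (≡.sym (ℕ.m+[n∸m]≡n k+m≤M))
        (≡.trans (≡.cong (ℕ._+ s) (ℕ.+-comm k m)) (ℕ.+-assoc m k s)))) (ℕ.m+n∸m≡n m _)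
  ... | inj₂ M≤k+m = begin
    qpoch (b * Q ^ m) k * qpoch (b * Q ^ k) s
      ≡⟨ ≡.cong (λ i → qpoch (b * Q ^ m) i * qpoch (b * Q ^ k) s) k≡t+w ⟩
    qpoch (b * Q ^ m) (t ℕ.+ w) * qpoch (b * Q ^ k) s
      ≈⟨ *-congʳ (qpoch-+ _ t w) ⟩
    (qpoch (b * Q ^ m) t * qpoch (b * Q ^ m * Q ^ t) w) * qpoch (b * Q ^ k) s
      ≈⟨ *-congʳ (*-congˡ (qpoch-cong w (trans (*-assoc-^ b m t)
           (trans (*-congˡ (^-congʳ Q (≡.trans m+t≡M (≡.sym k+s≡M)))) (sym (*-assoc-^ b k s)))))) ⟩
    (qpoch (b * Q ^ m) t * qpoch (b * Q ^ k * Q ^ s) w) * qpoch (b * Q ^ k) s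
      ≈⟨ solve 3 (λ x y z → (x :* y) :* z := x :* (z :* y)) refl _ _ _ ⟩
    qpoch (b * Q ^ m) t * (qpoch (b * Q ^ k) s * qpoch (b * Q ^ k * Q ^ s) w)
      ≈⟨ *-congˡ (qpoch-+ _ s w) ⟨
    qpoch (b * Q ^ m) t * qpoch (b * Q ^ k) (s ℕ.+ w)
      ≡⟨ ≡.cong (λ i → qpoch (b * Q ^ m) t * qpoch (b * Q ^ k) i) m≡s+w ⟨
    qpoch (b * Q ^ m) t * qpoch (b * Q ^ k) m ∎
    where
    s = M ∸ k
    t = M ∸ m
    w = (k ℕ.+ m) ∸ M
    k+s≡M : k ℕ.+ s ≡ M
    k+s≡M = ℕ.m+[n∸m]≡n k≤M
    m+t≡M : m ℕ.+ t ≡ M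
    m+t≡M = ℕ.m+[n∸m]≡n m≤M
    M+w≡k+m : M ℕ.+ w ≡ k ℕ.+ m
    M+w≡k+m = ℕ.m+[n∸m]≡n M≤k+m
    m≡s+w : m ≡ s ℕ.+ w
    m≡s+w = ℕ.+-cancelˡ-≡ k m (s ℕ.+ w)
      (≡.sym (≡.trans (≡.sym (ℕ.+-assoc k s w)) (≡.trans (≡.cong (ℕ._+ w) k+s≡M) M+w≡k+m)))
    k≡t+w : k ≡ t ℕ.+ w
    k≡t+w = ℕ.+-cancelˡ-≡ m k (t ℕ.+ w)
      (≡.sym (≡.trans (≡.sym (ℕ.+-assoc m t w)) (≡.trans (≡.cong (ℕ._+ w) m+t≡M)
        (≡.trans M+w≡k+m (ℕ.+-comm k m)))))

  -- (Q;Q)_M (c;Q)_k Q^k / (Q;Q)_k, with (Q;Q)_M / (Q;Q)_k written as (Q^{k+1};Q)_{M−k}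
  -- to stay division-free.
  weight : Carrier → ℕ → ℕ → Carrier
  weight c M k = qpoch c k * qpoch (Q * Q ^ k) (M ∸ k) * Q ^ k

  -- In divided form: the sum over k ≤ M of (c;Q)_k Q^k / (Q;Q)_k is (cQ;Q)_M / (Q;Q)_M. Passing
  -- from M to M + 1 multiplies every old term by 1 - Q^(M+1) and adds one new term.
  sum-weight : ∀ c M → sum (suc M) (weight c M) ≈ qpoch (c * Q) M
  sum-weight c zero = solve 0 (con (+ 0) :+ (con (+ 1) :* con (+ 1) :* con (+ 1)) := con (+ 1)) refl
  sum-weight c (suc M) = begin
    sum (suc M) (weight c (suc M)) + weight c (suc M) (suc M)
      ≈⟨ +-cong (trans (sum-cong< (suc M) (λ k k<1+M → step k (ℕ.s≤s⁻¹ k<1+M)))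
           (trans (sum-*ˡ (suc M) _ (weight c M)) (*-congˡ (sum-weight c M)))) last ⟩
    (1# - Q * Q ^ M) * qpoch (c * Q) M + qpoch (c * Q) M * (1# - c) * (Q * Q ^ M)
      ≈⟨ solve 4 (λ p x q r → (con (+ 1) :- q :* r) :* p :+ p :* (con (+ 1) :- x) :* (q :* r)
           := p :* (con (+ 1) :- (x :* q) :* r)) refl (qpoch (c * Q) M) c Q (Q ^ M) ⟩
    qpoch (c * Q) (suc M) ∎
    where
    step : ∀ k → k ≤ M → weight c (suc M) k ≈ (1# - Q * Q ^ M) * weight c M k
    step k k≤M = begin
      qpoch c k * qpoch (Q * Q ^ k) (suc M ∸ k) * Q ^ k
        ≡⟨ ≡.cong (λ i → qpoch c k * qpoch (Q * Q ^ k) i * Q ^ k) (ℕ.+-∸-assoc 1 k≤M) ⟩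
      qpoch c k * (qpoch (Q * Q ^ k) (M ∸ k) * (1# - Q * Q ^ k * Q ^ (M ∸ k))) * Q ^ k
        ≈⟨ *-congʳ (*-congˡ (*-congˡ (+-congˡ (-‿cong (trans (*-assoc-^ Q k _) (*-congˡ (^-congʳ Q (ℕ.m+[n∸m]≡n k≤M)))))))) ⟩
      qpoch c k * (qpoch (Q * Q ^ k) (M ∸ k) * (1# - Q * Q ^ M)) * Q ^ k
        ≈⟨ solve 4 (λ a b x y → a :* (b :* x) :* y := x :* (a :* b :* y)) refl _ _ _ _ ⟩
      (1# - Q * Q ^ M) * weight c M k ∎
    shift : ∀ k → qpoch c (suc k) ≈ (1# - c) * qpoch (c * Q) k
    shift k = trans (qpoch-+ c 1 k) (*-cong
      (solve 1 (λ x → con (+ 1) :* (con (+ 1) :- x :* con (+ 1)) := con (+ 1) :- x) refl c)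
      (qpoch-cong k (*-congˡ (*-identityʳ Q))))
    last : weight c (suc M) (suc M) ≈ qpoch (c * Q) M * (1# - c) * (Q * Q ^ M)
    last = begin
      qpoch c (suc M) * qpoch (Q * Q ^ suc M) (M ∸ M) * Q ^ suc M
        ≡⟨ ≡.cong (λ i → qpoch c (suc M) * qpoch (Q * Q ^ suc M) i * Q ^ suc M) (ℕ.n∸n≡0 M) ⟩
      qpoch c (suc M) * 1# * Q ^ suc M
        ≈⟨ *-congʳ (trans (*-identityʳ _) (trans (shift M) (*-comm _ _))) ⟩
      qpoch (c * Q) M * (1# - c) * (Q * Q ^ M) ∎

  -- A function of k that is a polynomial in Q^k, together with a factorisation into L linear
  -- factors of constant term 1. The Karlsson-Minton argument is an induction on this factorisation;
  -- `resp` closes it under pointwise equality.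
  data Split : ℕ → (ℕ → Carrier) → Set (c Level.⊔ ℓ) where
    one    : Split 0 (λ _ → 1#)
    factor : ∀ {L h} β → Split L h → Split (suc L) (λ k → (1# - β * Q ^ k) * h k)
    resp   : ∀ {L h h′} → (∀ k → h k ≈ h′ k) → Split L h → Split L h′

  Split-* : ∀ {L L′ h h′} → Split L h → Split L′ h′ → Split (L ℕ.+ L′) (λ k → h k * h′ k)
  Split-* one          t = resp (λ k → sym (*-identityˡ _)) t
  Split-* (factor β s) t = resp (λ k → sym (*-assoc _ _ _)) (factor β (Split-* s t))
  Split-* (resp e s)   t = resp (λ k → *-congʳ (e k)) (Split-* s t)

  Split-^ : ∀ {L h} e → Split L h → Split (e ℕ.* L) (λ k → h k ^ e)
  Split-^ zero    s = one
  Split-^ (suc e) s = Split-* s (Split-^ e s)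

  Split-qpoch : ∀ y m → Split m (λ k → qpoch (y * Q ^ k) m)
  Split-qpoch y zero    = one
  Split-qpoch y (suc m) = resp
    (λ k → trans (*-comm _ _) (*-congˡ (+-congˡ (-‿cong
      (solve 3 (λ a b x → (a :* b) :* x := (a :* x) :* b) refl y (Q ^ m) (Q ^ k))))))
    (factor (y * Q ^ m) (Split-qpoch y m))

  -- Both (c;Q)_k (cQ^k;Q)_j and (c;Q)_j (cQ^j;Q)_k are (c;Q)_(j+k), so the extra factor merely
  -- moves the parameter from c to cQ^j.
  sum-weight-qpoch : ∀ c M j → sum (suc M) (λ k → weight c M k * qpoch (c * Q ^ k) j)
                     ≈ qpoch c j * qpoch (c * Q ^ j * Q) M
  sum-weight-qpoch c M j = begin
    sum (suc M) (λ k → weight c M k * qpoch (c * Q ^ k) j)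
      ≈⟨ sum-cong< (suc M) (λ k _ → step k) ⟩
    sum (suc M) (λ k → qpoch c j * weight (c * Q ^ j) M k)
      ≈⟨ trans (sum-*ˡ (suc M) _ _) (*-congˡ (sum-weight (c * Q ^ j) M)) ⟩
    qpoch c j * qpoch (c * Q ^ j * Q) M ∎
    where
    step : ∀ k → weight c M k * qpoch (c * Q ^ k) j ≈ qpoch c j * weight (c * Q ^ j) M k
    step k = begin
      qpoch c k * b * x * qpoch (c * Q ^ k) j
        ≈⟨ solve 4 (λ a b x y → a :* b :* x :* y := (a :* y) :* (b :* x)) refl _ _ _ _ ⟩
      (qpoch c k * qpoch (c * Q ^ k) j) * (b * x)
        ≈⟨ *-congʳ (trans (sym (qpoch-+ c k j)) (trans (reflexive (≡.cong (qpoch c) (ℕ.+-comm k j))) (qpoch-+ c j k))) ⟩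
      (qpoch c j * qpoch (c * Q ^ j) k) * (b * x)
        ≈⟨ solve 4 (λ a b x y → (a :* y) :* (b :* x) := a :* (y :* b :* x)) refl _ _ _ _ ⟩
      qpoch c j * weight (c * Q ^ j) M k ∎
      where
      b = qpoch (Q * Q ^ k) (M ∸ k)
      x = Q ^ k

  -- The q-Karlsson–Minton sum at c = Q^{-N}.  Each linear factor is expanded as
  -- 1 − β X = (1 − γ) + γ (1 − c Q^j X), which either drops it or lengthens (c X;Q)_j.
  sum-weight-split-qpoch : ∀ c M N {L h} → Split L h → ∀ j → N ≤ M → c * Q ^ N ≈ 1# → L ℕ.+ j < N →
    sum (suc M) (λ k → weight c M k * (qpoch (c * Q ^ k) j * h k)) ≈ 0#
  sum-weight-split-qpoch c M N one j N≤M cQᴺ≈1 j<N = begin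
    sum (suc M) (λ k → weight c M k * (qpoch (c * Q ^ k) j * 1#))
      ≈⟨ sum-cong< (suc M) (λ k _ → *-congˡ (*-identityʳ _)) ⟩
    sum (suc M) (λ k → weight c M k * qpoch (c * Q ^ k) j)
      ≈⟨ sum-weight-qpoch c M j ⟩
    qpoch c j * qpoch (c * Q ^ j * Q) M
      -- The parameter c Q^(j+1) equals Q^(-(N-1-j)), so the factor of index N - 1 - j is zero; N ≤
      -- M keeps that index in range.
      ≈⟨ *-congˡ (qpoch-vanishes _ (N ∸ suc j) M (ℕ.<-≤-trans (ℕ.∸-monoʳ-< {N} (s≤s z≤n) j<N) N≤M) vanish) ⟩
    qpoch c j * 0#
      ≈⟨ zeroʳ _ ⟩
    0# ∎
    where
    vanish : c * Q ^ j * Q * Q ^ (N ∸ suc j) ≈ 1#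
    vanish = begin
      c * Q ^ j * Q * Q ^ (N ∸ suc j)
        ≈⟨ *-congʳ (solve 3 (λ a b x → a :* b :* x := a :* (x :* b)) refl c (Q ^ j) Q) ⟩
      c * Q ^ suc j * Q ^ (N ∸ suc j)
        ≈⟨ *-assoc-^ c (suc j) _ ⟩
      c * Q ^ (suc j ℕ.+ (N ∸ suc j))
        ≡⟨ ≡.cong (λ i → c * Q ^ i) (ℕ.m+[n∸m]≡n j<N) ⟩
      c * Q ^ N
        ≈⟨ cQᴺ≈1 ⟩
      1# ∎
  sum-weight-split-qpoch c M N {suc L} (factor {h = h} β s) j N≤M cQᴺ≈1 L+j<N = begin
    sum (suc M) (λ k → weight c M k * (qpoch (c * Q ^ k) j * ((1# - β * Q ^ k) * h k)))
      ≈⟨ sum-cong< (suc M) (λ k _ → expand k) ⟩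
    sum (suc M) (λ k → (1# - γ) * (weight c M k * (qpoch (c * Q ^ k) j * h k))
                     + γ * (weight c M k * (qpoch (c * Q ^ k) (suc j) * h k)))
      ≈⟨ trans (sum-+ (suc M) _ _) (+-cong (sum-*ˡ (suc M) _ _) (sum-*ˡ (suc M) _ _)) ⟩
    (1# - γ) * sum (suc M) (λ k → weight c M k * (qpoch (c * Q ^ k) j * h k))
    + γ * sum (suc M) (λ k → weight c M k * (qpoch (c * Q ^ k) (suc j) * h k))
      ≈⟨ +-cong (*-congˡ (sum-weight-split-qpoch c M N s j N≤M cQᴺ≈1 (ℕ.<-trans (ℕ.n<1+n _) L+j<N)))
                (*-congˡ (sum-weight-split-qpoch c M N s (suc j) N≤M cQᴺ≈1
                  (≡.subst (_< N) (≡.sym (ℕ.+-suc L j)) L+j<N))) ⟩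
    (1# - γ) * 0# + γ * 0#
      ≈⟨ solve 1 (λ g → (con (+ 1) :- g) :* con (+ 0) :+ g :* con (+ 0) := con (+ 0)) refl γ ⟩
    0# ∎
    where
    -- This is β / (c Q^j) without a division: c Q^N = 1 makes Q^(N-j) the inverse of c Q^j.
    γ = β * Q ^ (N ∸ j)
    j≤N : j ≤ N
    j≤N = ℕ.≤-trans (ℕ.m≤n+m j (suc L)) (ℕ.<⇒≤ L+j<N)
    γcQʲ≈β : γ * (c * Q ^ j) ≈ β
    γcQʲ≈β = begin
      β * Q ^ (N ∸ j) * (c * Q ^ j) ≈⟨ solve 4 (λ b x c y → b :* x :* (c :* y) := b :* (c :* y :* x)) refl _ _ _ _ ⟩
      β * (c * Q ^ j * Q ^ (N ∸ j)) ≈⟨ *-congˡ (*-assoc-^ c j _) ⟩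
      β * (c * Q ^ (j ℕ.+ (N ∸ j))) ≡⟨ ≡.cong (λ i → β * (c * Q ^ i)) (ℕ.m+[n∸m]≡n j≤N) ⟩
      β * (c * Q ^ N)               ≈⟨ trans (*-congˡ cQᴺ≈1) (*-identityʳ β) ⟩
      β                             ∎
    expand : ∀ k → weight c M k * (qpoch (c * Q ^ k) j * ((1# - β * Q ^ k) * h k))
      ≈ (1# - γ) * (weight c M k * (qpoch (c * Q ^ k) j * h k))
        + γ * (weight c M k * (qpoch (c * Q ^ k) (suc j) * h k))
    expand k = begin
      weight c M k * (qpoch (c * Q ^ k) j * ((1# - β * Q ^ k) * h k))
        ≈⟨ *-congˡ (*-congˡ (*-congʳ (+-congˡ (-‿cong (*-congʳ (sym γcQʲ≈β)))))) ⟩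
      weight c M k * (qpoch (c * Q ^ k) j * ((1# - γ * (c * Q ^ j) * Q ^ k) * h k))
        ≈⟨ solve 7 (λ w p g c y x h →
             w :* (p :* ((con (+ 1) :- g :* (c :* y) :* x) :* h))
             := (con (+ 1) :- g) :* (w :* (p :* h)) :+ g :* (w :* ((p :* (con (+ 1) :- c :* x :* y)) :* h)))
             refl (weight c M k) (qpoch (c * Q ^ k) j) γ c (Q ^ j) (Q ^ k) (h k) ⟩
      _ ∎
  sum-weight-split-qpoch c M N (resp e s) j N≤M cQᴺ≈1 L+j<N =
    trans (sum-cong< (suc M) (λ k _ → *-congˡ (*-congˡ (sym (e k)))))
      (sum-weight-split-qpoch c M N s j N≤M cQᴺ≈1 L+j<N)

  sum-weight-split : ∀ c M N {L h} → Split L h → N ≤ M → c * Q ^ N ≈ 1# → L < N →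
    sum (suc M) (λ k → weight c M k * h k) ≈ 0#
  sum-weight-split c M N {L} s N≤M cQᴺ≈1 L<N =
    trans (sum-cong< (suc M) (λ k _ → *-congˡ (sym (*-identityˡ _))))
      (sum-weight-split-qpoch c M N s 0 N≤M cQᴺ≈1 (≡.subst (_< N) (≡.sym (ℕ.+-identityʳ L)) L<N))

-- First-order expansion with ε² = 0

module FirstOrder {c ℓ : Level} (R : CommutativeRing c ℓ) (Q : CommutativeRing.Carrier R) where
  open CommutativeRing R
  open IntegerCoefficients R using (module Solver)
  open Solver using (solve; _:=_; _:+_; _:*_; _:-_; :-_; con)
  open Algebra.Properties.CommutativeSemiring.Exp commutativeSemiring
  open Relation.Binary.Reasoning.Setoid setoid
  open Pochhammer R Q

  SquareZero : Carrier → Set ℓ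
  SquareZero ε = ε * ε ≈ 0#

  -- The identities below are exact polynomial identities with their second-order remainder
  -- displayed as ε ε t; only here is ε² = 0 applied to it.
  drop : ∀ {ε x y t} → SquareZero ε → x ≈ y + ε * ε * t → x ≈ y
  drop {ε} {x} {y} {t} ε²≈0 x≈ = begin
    x                 ≈⟨ x≈ ⟩
    y + ε * ε * t     ≈⟨ +-congˡ (trans (*-congʳ ε²≈0) (zeroˡ t)) ⟩
    y + 0#            ≈⟨ +-identityʳ y ⟩
    y                 ∎

  -- The derivative x d/dx of (x;Q)_k, built up by the product rule.
  slope : Carrier → ℕ → Carrier
  slope x zero    = 0#
  slope x (suc k) = slope x k * (1# - x * Q ^ k) - qpoch x k * (x * Q ^ k)

  qpoch-linear : ∀ {ε} → SquareZero ε → ∀ x k →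
    qpoch (x * (1# + ε)) k ≈ qpoch x k + ε * slope x k
  qpoch-linear {ε} ε²≈0 x zero    = solve 1 (λ e → con (+ 1) := con (+ 1) :+ e :* con (+ 0)) refl ε
  qpoch-linear {ε} ε²≈0 x (suc k) = drop ε²≈0 (begin
    qpoch (x * (1# + ε)) k * (1# - x * (1# + ε) * Q ^ k)
      ≈⟨ *-congʳ (qpoch-linear ε²≈0 x k) ⟩
    (qpoch x k + ε * slope x k) * (1# - x * (1# + ε) * Q ^ k)
      ≈⟨ solve 5 (λ f e s x b → (f :+ e :* s) :* (con (+ 1) :- x :* (con (+ 1) :+ e) :* b)
           := (f :* (con (+ 1) :- x :* b) :+ e :* (s :* (con (+ 1) :- x :* b) :- f :* (x :* b)))
              :+ e :* e :* (:- (s :* (x :* b)))) refl (qpoch x k) ε (slope x k) x (Q ^ k) ⟩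
    _ ∎)

  qpoch-symmetric-difference : ∀ {ε} → SquareZero ε → ∀ x y k →
    qpoch (x * (1# + ε)) k * qpoch (y * (1# - ε)) k + qpoch (x * (1# - ε)) k * qpoch (y * (1# + ε)) k
    ≈ qpoch x k * qpoch y k + qpoch x k * qpoch y k
  -- The slopes at x and y are unrelated, so a single product is off by a multiple of ε; the product
  -- with opposite signs is off by the negative of it.
  qpoch-symmetric-difference {ε} ε²≈0 x y k = drop ε²≈0 (begin
    _ ≈⟨ +-cong (*-cong (qpoch-linear ε²≈0 x k) (qpoch-linear -ε²≈0 y k))
                (*-cong (qpoch-linear -ε²≈0 x k) (qpoch-linear ε²≈0 y k)) ⟩
    (qpoch x k + ε * slope x k) * (qpoch y k + - ε * slope y k)
      + (qpoch x k + - ε * slope x k) * (qpoch y k + ε * slope y k)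
      ≈⟨ solve 5 (λ e f s g t → (f :+ e :* s) :* (g :+ :- e :* t) :+ (f :+ :- e :* s) :* (g :+ e :* t)
           := (f :* g :+ f :* g) :+ e :* e :* (:- (s :* t :+ s :* t)))
           refl ε (qpoch x k) (slope x k) (qpoch y k) (slope y k) ⟩
    _ ∎)
    where
    -ε²≈0 : SquareZero (- ε)
    -ε²≈0 = trans (solve 1 (λ e → :- e :* :- e := e :* e) refl ε) ε²≈0

  -- Holds factor by factor: on each side the two relative perturbations of x add up to ε w at first
  -- order, and the rest is a multiple of ε².
  qpoch-shift : ∀ {ε} → SquareZero ε → ∀ x w k →
    qpoch (x * (1# - ε)) k * qpoch (x * ((1# + ε) * (1# + ε * w))) k
    ≈ qpoch (x * (1# + ε * w)) k * qpoch x k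
  qpoch-shift {ε} ε²≈0 x w zero    = refl
  qpoch-shift {ε} ε²≈0 x w (suc k) = begin
    _ ≈⟨ interchange _ _ _ _ ⟩
    (qpoch (x * (1# - ε)) k * qpoch (x * ((1# + ε) * (1# + ε * w))) k)
      * ((1# - x * (1# - ε) * Q ^ k) * (1# - x * ((1# + ε) * (1# + ε * w)) * Q ^ k))
      ≈⟨ *-cong (qpoch-shift ε²≈0 x w k) (drop ε²≈0
           (solve 4 (λ e x w b →
              (con (+ 1) :- x :* (con (+ 1) :- e) :* b)
                :* (con (+ 1) :- x :* ((con (+ 1) :+ e) :* (con (+ 1) :+ e :* w)) :* b)
              := (con (+ 1) :- x :* (con (+ 1) :+ e :* w) :* b) :* (con (+ 1) :- x :* b)
                 :+ e :* e :* (:- ((con (+ 1) :- x :* b) :* (x :* b :* w))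
                    :- x :* b :* (x :* b) :* (con (+ 1) :+ w :+ e :* w)))
              refl ε x w (Q ^ k))) ⟩
    (qpoch (x * (1# + ε * w)) k * qpoch x k)
      * ((1# - x * (1# + ε * w) * Q ^ k) * (1# - x * Q ^ k))
      ≈⟨ interchange _ _ _ _ ⟩
    _ ∎
    where
    interchange : ∀ a b c d → (a * b) * (c * d) ≈ (a * c) * (b * d)
    interchange = solve 4 (λ a b c d → (a :* b) :* (c :* d) := (a :* c) :* (b :* d)) refl

  module Unipotent {u v : Carrier} (uv≈1 : u * v ≈ 1#) (ε²≈0 : SquareZero (u - 1#)) where
    ε = u - 1#

    -- The geometric sum 1 + u + ... + u^(j-1), so that the expansion of u^j below is exact.
    cofactor : ℕ → Carrier
    cofactor zero    = 0#
    cofactor (suc j) = u * cofactor j + 1#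

    u≈1+ε : u ≈ 1# + ε
    u≈1+ε = solve 1 (λ u → u := con (+ 1) :+ (u :- con (+ 1))) refl u

    uʲ≈1+ε : ∀ j → u ^ j ≈ 1# + ε * cofactor j
    uʲ≈1+ε zero    = solve 1 (λ e → con (+ 1) := con (+ 1) :+ e :* con (+ 0)) refl ε
    uʲ≈1+ε (suc j) = trans (*-congˡ (uʲ≈1+ε j))
      (solve 2 (λ u w → u :* (con (+ 1) :+ (u :- con (+ 1)) :* w)
         := con (+ 1) :+ (u :- con (+ 1)) :* (u :* w :+ con (+ 1))) refl u (cofactor j))

    squareZero-* : ∀ w → SquareZero (ε * w)
    squareZero-* w = trans (solve 2 (λ e w → (e :* w) :* (e :* w) := (e :* e) :* (w :* w)) refl ε w)
      (trans (*-congʳ ε²≈0) (zeroˡ _))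

    inverse≈1-ε : ∀ {x y δ} → SquareZero δ → x * y ≈ 1# → x ≈ 1# + δ → y ≈ 1# - δ
    inverse≈1-ε {x} {y} {δ} δ²≈0 xy≈1 x≈1+δ = begin
      y                            ≈⟨ drop {t = y} δ²≈0 (solve 2 (λ d y → y
                                       := (con (+ 1) :- d) :* ((con (+ 1) :+ d) :* y) :+ d :* d :* y) refl δ y) ⟩
      (1# - δ) * ((1# + δ) * y)    ≈⟨ *-congˡ (trans (*-congʳ (sym x≈1+δ)) xy≈1) ⟩
      (1# - δ) * 1#                ≈⟨ *-identityʳ _ ⟩
      1# - δ                       ∎

    v≈1-ε : v ≈ 1# - ε
    v≈1-ε = inverse≈1-ε ε²≈0 uv≈1 u≈1+ε

    uʲvʲ≈1 : ∀ j → u ^ j * v ^ j ≈ 1#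
    uʲvʲ≈1 j = trans (sym (^-distrib-* u v j)) (trans (^-congˡ j uv≈1) (1^k≈1 j))

    vʲ≈1-ε : ∀ j → v ^ j ≈ 1# - ε * cofactor j
    vʲ≈1-ε j = inverse≈1-ε (squareZero-* (cofactor j)) (uʲvʲ≈1 j) (uʲ≈1+ε j)

    qpoch-conjugates : ∀ x y j k →
      qpoch (x * u ^ j) k * qpoch (y * v ^ j) k + qpoch (x * v ^ j) k * qpoch (y * u ^ j) k
      ≈ qpoch x k * qpoch y k + qpoch x k * qpoch y k
    qpoch-conjugates x y j k = trans
      (+-cong (*-cong (qpoch-cong k (*-congˡ (uʲ≈1+ε j))) (qpoch-cong k (*-congˡ (vʲ≈1-ε j))))
              (*-cong (qpoch-cong k (*-congˡ (vʲ≈1-ε j))) (qpoch-cong k (*-congˡ (uʲ≈1+ε j)))))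
      (qpoch-symmetric-difference (squareZero-* (cofactor j)) x y k)

    -- The total exponent of u is zero: -1 taken j times, and j once. The induction uses
    -- `qpoch-shift` to let one factor with v lower the exponent of u^(j+1) by one, which leaves an
    -- unperturbed factor behind.
    qpoch-v-u^ : ∀ x k j →
      qpoch (x * v) k ^ j * qpoch (x * u ^ j) k ≈ qpoch x k ^ suc j
    qpoch-v-u^ x k zero = trans (*-identityˡ _)
      (trans (qpoch-cong k (*-identityʳ x)) (sym (*-identityʳ _)))
    qpoch-v-u^ x k (suc j) = begin
      qpoch (x * v) k * qpoch (x * v) k ^ j * qpoch (x * (u * u ^ j)) k
        ≈⟨ solve 3 (λ a b c → a :* b :* c := b :* (a :* c)) refl _ _ _ ⟩
      qpoch (x * v) k ^ j * (qpoch (x * v) k * qpoch (x * (u * u ^ j)) k)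
        ≈⟨ *-congˡ (*-cong (qpoch-cong k (*-congˡ v≈1-ε))
                           (qpoch-cong k (*-congˡ (*-cong u≈1+ε (uʲ≈1+ε j))))) ⟩
      qpoch (x * v) k ^ j * (qpoch (x * (1# - ε)) k * qpoch (x * ((1# + ε) * (1# + ε * cofactor j))) k)
        ≈⟨ *-congˡ (trans (qpoch-shift ε²≈0 x (cofactor j) k)
                          (*-congʳ (qpoch-cong k (*-congˡ (sym (uʲ≈1+ε j)))))) ⟩
      qpoch (x * v) k ^ j * (qpoch (x * u ^ j) k * qpoch x k)
        ≈⟨ trans (sym (*-assoc _ _ _)) (*-congʳ (qpoch-v-u^ x k j)) ⟩
      qpoch x k ^ suc j * qpoch x k
        ≈⟨ *-comm _ _ ⟩
      qpoch x k ^ suc (suc j) ∎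

-- Vanishing of the doubled sum to first order

-- Here d = 2 + e and m = 2 + r, so n = suc M.
module Vanishing {c ℓ : Level} (R : CommutativeRing c ℓ) (q p : CommutativeRing.Carrier R) (e : ℕ) where
  open CommutativeRing R hiding (zero)
  open IntegerCoefficients R using (module Solver)
  open Solver using (solve; _:=_; _:+_; _:*_; con)
  open Algebra.Properties.CommutativeSemiring.Exp commutativeSemiring
  open Relation.Binary.Reasoning.Setoid setoid

  Q : Carrier
  Q = q ^ (2 ℕ.+ e)

  open Sums R
  open Pochhammer R Q
  open FirstOrder R Q

  -- Once p is inverse to q, `p ^ suc e` is q/Q. The last factor is the d-th power of (Q;Q)_M /
  -- (Q;Q)_k.
  term : ℕ → ℕ → Carrier
  term M k = qpoch (q * Q) k ^ e * qpoch q k * qpoch (p ^ suc e) k * Q ^ k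
             * qpoch (Q * Q ^ k) (M ∸ k) ^ (2 ℕ.+ e)

  module _ (r : ℕ) where

    open +-*-Solver using (Polynomial; ⟦_⟧; prove)
      renaming (var to varℕ; con to conℕ; _:+_ to _:+ℕ_; _:*_ to _:*ℕ_)

    E Rᵖ Mᵖ : Polynomial 2
    E  = varℕ zero
    Rᵖ = varℕ (suc zero)
    Mᵖ = Rᵖ :+ℕ (conℕ 2 :+ℕ Rᵖ) :+ℕ E :*ℕ (conℕ 2 :+ℕ Rᵖ)

    value : Polynomial 2 → ℕ
    value i = ⟦ i ⟧ (e ∷ r ∷ [])

    M m N₁ N₂ : ℕ
    M  = value Mᵖ
    m  = 2 ℕ.+ r
    N₁ = suc e ℕ.* m
    N₂ = suc (r ℕ.+ e ℕ.* m)

    module _ (qp≈1 : q * p ≈ 1#) (ε²≈0 : SquareZero (q ^ suc M - 1#)) where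

      u v y y′ a : Carrier
      u  = q ^ suc M
      v  = p ^ suc M
      a  = p ^ suc e
      y  = Q * v
      y′ = Q * u ^ e

      interchange : ∀ a b c d → a * b * (c * d) ≈ (a * c) * (b * d)
      interchange = solve 4 (λ a b c d → a :* b :* (c :* d) := (a :* c) :* (b :* d)) refl

      qʲpʲ≈1 : ∀ j → q ^ j * p ^ j ≈ 1#
      qʲpʲ≈1 j = trans (sym (^-distrib-* q p j)) (trans (^-congˡ j qp≈1) (1^k≈1 j))

      -- q^i p^j depends only on i - j; the hypothesis states equality of these differences within
      -- ℕ.
      monomial-cong : ∀ i j i′ j′ → i ℕ.+ j′ ≡ i′ ℕ.+ j → q ^ i * p ^ j ≈ q ^ i′ * p ^ j′
      monomial-cong i j i′ j′ i+j′≡i′+j = begin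
        q ^ i * p ^ j                       ≈⟨ *-identityʳ _ ⟨
        q ^ i * p ^ j * 1#                  ≈⟨ *-congˡ (qʲpʲ≈1 j′) ⟨
        q ^ i * p ^ j * (q ^ j′ * p ^ j′)   ≈⟨ interchange _ _ _ _ ⟩
        (q ^ i * q ^ j′) * (p ^ j * p ^ j′) ≈⟨ *-congʳ (^-homo-* q i j′) ⟨
        q ^ (i ℕ.+ j′) * (p ^ j * p ^ j′)   ≡⟨ ≡.cong (λ t → q ^ t * (p ^ j * p ^ j′)) i+j′≡i′+j ⟩
        q ^ (i′ ℕ.+ j) * (p ^ j * p ^ j′)   ≈⟨ *-cong (^-homo-* q i′ j) (*-comm _ _) ⟩
        (q ^ i′ * q ^ j) * (p ^ j′ * p ^ j) ≈⟨ interchange _ _ _ _ ⟨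
        q ^ i′ * p ^ j′ * (q ^ j * p ^ j)   ≈⟨ *-congˡ (qʲpʲ≈1 j) ⟩
        q ^ i′ * p ^ j′ * 1#                ≈⟨ *-identityʳ _ ⟩
        q ^ i′ * p ^ j′                     ∎

      -- Monomials q^i p^j whose exponents are symbolic polynomials in e and r, so
      -- that identities between them are decided by normalising exponents.
      record Monomial (x : Carrier) : Set ℓ where
        constructor monomial
        field
          i j : Polynomial 2
          eq  : x ≈ q ^ value i * p ^ value j
      open Monomial

      infixl 7 _⊛_
      _⊛_ : ∀ {x z} → Monomial x → Monomial z → Monomial (x * z)
      _⊛_ {x} {z} (monomial i j eq) (monomial i′ j′ eq′) = monomial (i :+ℕ i′) (j :+ℕ j′) (begin
        x * z
          ≈⟨ *-cong eq eq′ ⟩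
        q ^ value i * p ^ value j * (q ^ value i′ * p ^ value j′)
          ≈⟨ interchange _ _ _ _ ⟩
        (q ^ value i * q ^ value i′) * (p ^ value j * p ^ value j′)
          ≈⟨ *-cong (^-homo-* q (value i) (value i′)) (^-homo-* p (value j) (value j′)) ⟨
        q ^ value (i :+ℕ i′) * p ^ value (j :+ℕ j′) ∎)

      infixr 8 _⊛^_
      _⊛^_ : ∀ {x} → Monomial x → ∀ k → Monomial (x ^ value k)
      _⊛^_ {x} (monomial i j eq) k = monomial (i :*ℕ k) (j :*ℕ k) (begin
        x ^ value k
          ≈⟨ ^-congˡ (value k) eq ⟩
        (q ^ value i * p ^ value j) ^ value k
          ≈⟨ ^-distrib-* (q ^ value i) (p ^ value j) (value k) ⟩
        (q ^ value i) ^ value k * (p ^ value j) ^ value k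
          ≈⟨ *-cong (^-assocʳ q (value i) (value k)) (^-assocʳ p (value j) (value k)) ⟩
        q ^ value (i :*ℕ k) * p ^ value (j :*ℕ k) ∎)

      by-exponents : ∀ {x z} (s : Monomial x) (t : Monomial z) →
        +-*-Solver.⟦ i s :+ℕ j t ⟧↓ (e ∷ r ∷ []) ≡ +-*-Solver.⟦ i t :+ℕ j s ⟧↓ (e ∷ r ∷ []) → x ≈ z
      by-exponents (monomial i j eq) (monomial i′ j′ eq′) normal≡ = trans eq
        (trans (monomial-cong (value i) (value j) (value i′) (value j′)
                  (prove (e ∷ r ∷ []) (i :+ℕ j′) (i′ :+ℕ j) normal≡))
               (sym eq′))

      q̂ : Monomial q
      q̂ = monomial (conℕ 1) (conℕ 0) (sym (trans (*-identityʳ _) (*-identityʳ q)))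

      p̂ : Monomial p
      p̂ = monomial (conℕ 0) (conℕ 1) (sym (trans (*-identityˡ _) (*-identityʳ p)))

      1̂ : Monomial 1#
      1̂ = monomial (conℕ 0) (conℕ 0) (sym (*-identityˡ 1#))

      Q̂ : Monomial Q
      Q̂ = q̂ ⊛^ (conℕ 2 :+ℕ E)

      û : Monomial u
      û = q̂ ⊛^ (conℕ 1 :+ℕ Mᵖ)

      v̂ : Monomial v
      v̂ = p̂ ⊛^ (conℕ 1 :+ℕ Mᵖ)

      â : Monomial a
      â = p̂ ⊛^ (conℕ 1 :+ℕ E)

      ŷ′ : Monomial y′
      ŷ′ = Q̂ ⊛ û ⊛^ E

      -- This relation and the next four are all instances of q u = Q^m. In particular a v^(d-1) =
      -- (q u)^(-(d-1)) gives N₁ = (d - 1) m, and q = Q a gives N₂ = N₁ - 1.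
      qQ≈yQᵐ : q * Q ≈ y * Q ^ m
      qQ≈yQᵐ = by-exponents (q̂ ⊛ Q̂) (Q̂ ⊛ v̂ ⊛ Q̂ ⊛^ (conℕ 2 :+ℕ Rᵖ)) ≡.refl

      quᵈ⁻¹≈y′Qᵐ⁻¹ : q * u ^ suc e ≈ y′ * Q ^ suc r
      quᵈ⁻¹≈y′Qᵐ⁻¹ = by-exponents (q̂ ⊛ û ⊛^ (conℕ 1 :+ℕ E)) (ŷ′ ⊛ Q̂ ⊛^ (conℕ 1 :+ℕ Rᵖ)) ≡.refl

      auᵈ⁻¹≈y′Qᵐ⁻² : a * u ^ suc e ≈ y′ * Q ^ r
      auᵈ⁻¹≈y′Qᵐ⁻² = by-exponents (â ⊛ û ⊛^ (conℕ 1 :+ℕ E)) (ŷ′ ⊛ Q̂ ⊛^ Rᵖ) ≡.refl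

      avᵈ⁻¹≈Q⁻ᴺ¹ : a * v ^ suc e * Q ^ N₁ ≈ 1#
      avᵈ⁻¹≈Q⁻ᴺ¹ = by-exponents
        (â ⊛ v̂ ⊛^ (conℕ 1 :+ℕ E) ⊛ Q̂ ⊛^ ((conℕ 1 :+ℕ E) :*ℕ (conℕ 2 :+ℕ Rᵖ))) 1̂ ≡.refl

      qvᵈ⁻¹≈Q⁻ᴺ² : q * v ^ suc e * Q ^ N₂ ≈ 1#
      qvᵈ⁻¹≈Q⁻ᴺ² = by-exponents
        (q̂ ⊛ v̂ ⊛^ (conℕ 1 :+ℕ E) ⊛ Q̂ ⊛^ (conℕ 1 :+ℕ (Rᵖ :+ℕ E :*ℕ (conℕ 2 :+ℕ Rᵖ)))) 1̂ ≡.refl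

      open Unipotent {u} {v} (qʲpʲ≈1 (suc M)) ε²≈0 using (qpoch-conjugates; qpoch-v-u^)

      m≤M : m ≤ M
      m≤M = ℕ.≤-trans (ℕ.m≤n+m m r) (ℕ.m≤m+n (r ℕ.+ m) (e ℕ.* m))

      -- One half of the sum, as produced by a perturbation sending one of the
      -- numerator parameters to x ≈ y′Q^l and the other to c ≈ Q^{-N}.
      half : Carrier → Carrier → ℕ → Carrier
      half x c k = (qpoch (q * Q) k * qpoch (y * Q ^ k) (M ∸ k)) ^ e
                   * (qpoch x k * qpoch (y′ * Q ^ k) (M ∸ k)) * weight c M k

      -- By `qpoch-exchange`, each numerator factor times its cleared denominator is a constant
      -- times a product of linear factors in Q^k: m of them for each of the e pairs with y, and l
      -- for the pair with y′. The total degree is e m + l.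
      sum-half : ∀ x c l N → x ≈ y′ * Q ^ l → c * Q ^ N ≈ 1# →
        l ≤ M → N ≤ M → e ℕ.* m ℕ.+ l < N → sum (suc M) (half x c) ≈ 0#
      sum-half x c l N x≈y′Qˡ cQᴺ≈1 l≤M N≤M deg<N = begin
        sum (suc M) (half x c)
          ≈⟨ sum-cong< (suc M) (λ k k<1+M → step k (ℕ.s≤s⁻¹ k<1+M)) ⟩
        sum (suc M) (λ k → C * (weight c M k * h k))
          ≈⟨ sum-*ˡ (suc M) C _ ⟩
        C * sum (suc M) (λ k → weight c M k * h k)
          ≈⟨ *-congˡ (sum-weight-split c M N
               (Split-* (Split-^ e (Split-qpoch y m)) (Split-qpoch y′ l)) N≤M cQᴺ≈1 deg<N) ⟩
        C * 0#
          ≈⟨ zeroʳ C ⟩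
        0# ∎
        where
        C₁ C₂ C : Carrier
        C₁ = qpoch (y * Q ^ m) (M ∸ m)
        C₂ = qpoch (y′ * Q ^ l) (M ∸ l)
        C  = C₁ ^ e * C₂
        h : ℕ → Carrier
        h k = qpoch (y * Q ^ k) m ^ e * qpoch (y′ * Q ^ k) l
        step : ∀ k → k ≤ M → half x c k ≈ C * (weight c M k * h k)
        step k k≤M = begin
          half x c k
            ≈⟨ *-congʳ (*-cong
                 (trans (^-congˡ e (trans (*-congʳ (qpoch-cong k qQ≈yQᵐ)) (qpoch-exchange y m k M m≤M k≤M)))
                        (^-distrib-* C₁ _ e))
                 (trans (*-congʳ (qpoch-cong k x≈y′Qˡ)) (qpoch-exchange y′ l k M l≤M k≤M))) ⟩
          (C₁ ^ e * qpoch (y * Q ^ k) m ^ e) * (C₂ * qpoch (y′ * Q ^ k) l) * weight c M k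
            ≈⟨ solve 5 (λ a b c d w → (a :* b) :* (c :* d) :* w := (a :* c) :* (w :* (b :* d))) refl _ _ _ _ _ ⟩
          C * (weight c M k * h k) ∎

      -- Of the d copies of f one stays unperturbed for the weight, and the other e + 1 become f₁^e
      -- f₂. Of g and h, the one that receives u^(d-1) is paired with f₂, and the one that receives
      -- v^(d-1) becomes the terminating parameter; the two halves exchange these roles.
      term+term≈half+half : ∀ k → term M k + term M k
        ≈ half (q * u ^ suc e) (a * v ^ suc e) k + half (a * u ^ suc e) (q * v ^ suc e) k
      term+term≈half+half k = begin
        A ^ e * g * h * X * (f * (f * f ^ e)) + A ^ e * g * h * X * (f * (f * f ^ e))
          ≈⟨ solve 6 (λ A g h X f F → A :* g :* h :* X :* (f :* (f :* F)) :+ A :* g :* h :* X :* (f :* (f :* F))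
               := A :* X :* f :* (f :* F) :* (g :* h :+ g :* h)) refl (A ^ e) g h X f (f ^ e) ⟩
        A ^ e * X * f * (f * f ^ e) * (g * h + g * h)
          ≈⟨ *-cong (*-congˡ (trans (sym (qpoch-v-u^ _ (M ∸ k) e))
               (*-cong (^-congˡ e (qpoch-cong (M ∸ k) (swap v))) (qpoch-cong (M ∸ k) (swap (u ^ e))))))
               (sym (qpoch-conjugates q a (suc e) k)) ⟩
        A ^ e * X * f * (f₁ ^ e * f₂) * (g⁺ * h⁻ + g⁻ * h⁺)
          ≈⟨ *-congˡ (+-congˡ (*-comm g⁻ h⁺)) ⟩
        A ^ e * X * f * (f₁ ^ e * f₂) * (g⁺ * h⁻ + h⁺ * g⁻)
          ≈⟨ distribˡ _ _ _ ⟩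
        A ^ e * X * f * (f₁ ^ e * f₂) * (g⁺ * h⁻) + A ^ e * X * f * (f₁ ^ e * f₂) * (h⁺ * g⁻)
          ≈⟨ +-cong (regroup g⁺ h⁻) (regroup h⁺ g⁻) ⟩
        (A * f₁) ^ e * (g⁺ * f₂) * (h⁻ * f * X) + (A * f₁) ^ e * (h⁺ * f₂) * (g⁻ * f * X) ∎
        where
        A g h X f f₁ f₂ g⁺ g⁻ h⁺ h⁻ : Carrier
        A  = qpoch (q * Q) k
        g  = qpoch q k
        h  = qpoch a k
        X  = Q ^ k
        f  = qpoch (Q * Q ^ k) (M ∸ k)
        f₁ = qpoch (y * Q ^ k) (M ∸ k)
        f₂ = qpoch (y′ * Q ^ k) (M ∸ k)
        g⁺ = qpoch (q * u ^ suc e) k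
        g⁻ = qpoch (q * v ^ suc e) k
        h⁺ = qpoch (a * u ^ suc e) k
        h⁻ = qpoch (a * v ^ suc e) k
        swap : ∀ x → Q * Q ^ k * x ≈ Q * x * Q ^ k
        swap x = solve 3 (λ a b c → a :* b :* c := a :* c :* b) refl Q (Q ^ k) x
        regroup : ∀ s t → A ^ e * X * f * (f₁ ^ e * f₂) * (s * t) ≈ (A * f₁) ^ e * (s * f₂) * (t * f * X)
        regroup s t = trans
          (solve 7 (λ A X f F f₂ s t → A :* X :* f :* (F :* f₂) :* (s :* t)
            := (A :* F) :* (s :* f₂) :* (t :* f :* X)) refl (A ^ e) X f (f₁ ^ e) f₂ s t)
          (*-congʳ (*-congʳ (sym (^-distrib-* A f₁ e))))

      sum-term+sum-term≈0 : sum (suc M) (term M) + sum (suc M) (term M) ≈ 0#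
      sum-term+sum-term≈0 = begin
        sum (suc M) (term M) + sum (suc M) (term M)
          ≈⟨ sum-+ (suc M) (term M) (term M) ⟨
        sum (suc M) (λ k → term M k + term M k)
          ≈⟨ sum-cong< (suc M) (λ k _ → term+term≈half+half k) ⟩
        sum (suc M) (λ k → half (q * u ^ suc e) (a * v ^ suc e) k + half (a * u ^ suc e) (q * v ^ suc e) k)
          ≈⟨ sum-+ (suc M) _ _ ⟩
        sum (suc M) (half (q * u ^ suc e) (a * v ^ suc e)) + sum (suc M) (half (a * u ^ suc e) (q * v ^ suc e))
          -- The degrees are e m + (m - 1) against N₁ = e m + m, and e m + (m - 2) against N₂ = e m
          -- + m - 1. The bound N₁ ≤ M, that is (d - 1) m ≤ d m - 2, is where m ≥ 2 enters.
          ≈⟨ +-cong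
               (sum-half _ _ (suc r) N₁ quᵈ⁻¹≈y′Qᵐ⁻¹ avᵈ⁻¹≈Q⁻ᴺ¹ (ℕ.≤-trans (ℕ.n≤1+n (suc r)) m≤M)
                 (ℕ.+-monoˡ-≤ (e ℕ.* m) (ℕ.m≤n+m m r))
                 (≡.subst (suc (e ℕ.* m ℕ.+ suc r) ≤_) (ℕ.+-comm (e ℕ.* m) m)
                   (ℕ.+-monoʳ-< (e ℕ.* m) (ℕ.n<1+n (suc r)))))
               (sum-half _ _ r N₂ auᵈ⁻¹≈y′Qᵐ⁻² qvᵈ⁻¹≈Q⁻ᴺ² (ℕ.≤-trans (ℕ.m≤n+m r 2) m≤M)
                 (ℕ.+-monoˡ-≤ (e ℕ.* m) (ℕ.≤-trans (ℕ.n≤1+n (suc r)) (ℕ.m≤n+m m r)))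
                 (s≤s (ℕ.≤-reflexive (ℕ.+-comm (e ℕ.* m) r)))) ⟩
        0# + 0#
          ≈⟨ +-identityˡ 0# ⟩
        0# ∎

-- The quotient of a ring by one element

module Quotient {c ℓ : Level} (R : CommutativeRing c ℓ) (w : CommutativeRing.Carrier R) where
  open CommutativeRing R
  open IntegerCoefficients R using (module Solver)
  open Solver using (solve; _:=_; _:+_; _:*_; :-_; con)

  infix 4 _≈ₘ_
  -- Carrier and operations stay the same and only equality is coarsened. The multiplier of w is
  -- stored, so a congruence proved in the quotient returns an explicit cofactor.
  record _≈ₘ_ (x y : Carrier) : Set (c Level.⊔ ℓ) where
    constructor _by_
    field
      factor : Carrier
      eq     : x ≈ y + w * factor

  embed : ∀ {x y} → x ≈ y → x ≈ₘ y
  embed {x} {y} x≈y = 0# by trans x≈y (solve 2 (λ y w → y := y :+ w :* con (+ 0)) refl y w)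

  reflₘ : ∀ {x} → x ≈ₘ x
  reflₘ = embed refl

  symₘ : ∀ {x y} → x ≈ₘ y → y ≈ₘ x
  symₘ {x} {y} (k by eq) = (- k) by trans
    (solve 3 (λ y w k → y := (y :+ w :* k) :+ w :* (:- k)) refl y w k) (+-congʳ (sym eq))

  transₘ : ∀ {x y z} → x ≈ₘ y → y ≈ₘ z → x ≈ₘ z
  transₘ {x} {y} {z} (k by eq) (l by eq′) = (l + k) by trans eq (trans (+-congʳ eq′)
    (solve 4 (λ z w k l → z :+ w :* l :+ w :* k := z :+ w :* (l :+ k)) refl z w k l))

  +-congₘ : ∀ {x y x′ y′} → x ≈ₘ y → x′ ≈ₘ y′ → x + x′ ≈ₘ y + y′
  +-congₘ {y = y} {y′ = y′} (k by eq) (l by eq′) = (k + l) by trans (+-cong eq eq′)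
    (solve 5 (λ y y′ w k l → (y :+ w :* k) :+ (y′ :+ w :* l) := (y :+ y′) :+ w :* (k :+ l)) refl y y′ w k l)

  *-congₘ : ∀ {x y x′ y′} → x ≈ₘ y → x′ ≈ₘ y′ → x * x′ ≈ₘ y * y′
  *-congₘ {y = y} {y′ = y′} (k by eq) (l by eq′) = (k * y′ + y * l + w * k * l) by trans (*-cong eq eq′)
    (solve 5 (λ y y′ w k l → (y :+ w :* k) :* (y′ :+ w :* l)
      := (y :* y′) :+ w :* (k :* y′ :+ y :* l :+ w :* k :* l)) refl y y′ w k l)

  -‿congₘ : ∀ {x y} → x ≈ₘ y → - x ≈ₘ - y
  -‿congₘ {y = y} (k by eq) = (- k) by trans (-‿cong eq)
    (solve 3 (λ y w k → :- (y :+ w :* k) := :- y :+ w :* (:- k)) refl y w k)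

  quotient : CommutativeRing c (c Level.⊔ ℓ)
  quotient = record
    { Carrier = Carrier ; _≈_ = _≈ₘ_ ; _+_ = _+_ ; _*_ = _*_ ; -_ = -_ ; 0# = 0# ; 1# = 1#
    ; isCommutativeRing = record
      { isRing = record
        { +-isAbelianGroup = record
          { isGroup = record
            { isMonoid = record
              { isSemigroup = record
                { isMagma = record
                  { isEquivalence = record { refl = reflₘ ; sym = symₘ ; trans = transₘ }
                  ; ∙-cong = +-congₘ }
                ; assoc = λ x y z → embed (+-assoc x y z) }
              ; identity = (λ x → embed (+-identityˡ x)) , (λ x → embed (+-identityʳ x)) }
            ; inverse = (λ x → embed (-‿inverseˡ x)) , (λ x → embed (-‿inverseʳ x))
            ; ⁻¹-cong = -‿congₘ }
          ; comm = λ x y → embed (+-comm x y) }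
        ; *-cong = *-congₘ
        ; *-assoc = λ x y z → embed (*-assoc x y z)
        ; *-identity = (λ x → embed (*-identityˡ x)) , (λ x → embed (*-identityʳ x))
        ; distrib = (λ x y z → embed (distribˡ x y z)) , (λ x y z → embed (distribʳ x y z)) }
      ; *-comm = λ x y → embed (*-comm x y) } }

  private
    open Algebra.Properties.CommutativeSemiring.Exp commutativeSemiring using (_^_)
    module Exp/ = Algebra.Properties.CommutativeSemiring.Exp (CommutativeRing.commutativeSemiring quotient)
    module Pochhammer/ = Pochhammer quotient

  -- Powers over R and over the quotient unfold to the same products, but at a variable exponent
  -- they are distinct stuck terms, hence the inductions here and below.
  ^-quotient : ∀ x k → x ^ k ≡ x Exp/.^ k
  ^-quotient x zero    = ≡.refl
  ^-quotient x (suc k) = ≡.cong (x *_) (^-quotient x k)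

  qpoch-quotient : ∀ Q x k → Pochhammer.qpoch R Q x k ≡ Pochhammer/.qpoch Q x k
  qpoch-quotient Q x zero    = ≡.refl
  qpoch-quotient Q x (suc k) =
    ≡.cong₂ (λ a b → a * (1# - x * b)) (qpoch-quotient Q x k) (^-quotient Q k)

  homogeneous-quotient : ∀ Q X Y k → Pochhammer.homogeneous R Q X Y k ≡ Pochhammer/.homogeneous Q X Y k
  homogeneous-quotient Q X Y zero    = ≡.refl
  homogeneous-quotient Q X Y (suc k) =
    ≡.cong₂ (λ a b → a * (Y - X * b)) (homogeneous-quotient Q X Y k) (^-quotient Q k)

-- Clearing denominators, and divisibility of the cleared sum

module ClearedSum {c ℓ : Level} (R : CommutativeRing c ℓ) (q : CommutativeRing.Carrier R) (e r : ℕ) where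
  open CommutativeRing R hiding (zero)
  open IntegerCoefficients R using (module Solver)
  open Solver using (solve; _:=_; _:*_)
  open Algebra.Properties.CommutativeSemiring.Exp commutativeSemiring
  open Sums R using (sum)

  Q Y : Carrier
  Q = q ^ (2 ℕ.+ e)
  Y = q ^ suc e

  open Pochhammer R Q

  M : ℕ
  M = r ℕ.+ (2 ℕ.+ r) ℕ.+ e ℕ.* (2 ℕ.+ r)

  -- clearedTerm k / (Y^M (Q;Q)_M^d) is the k-th summand.
  numerator scale clearedTerm : ℕ → Carrier
  numerator k = qpoch (q * Q) k ^ e * qpoch q k * homogeneous 1# Y k * Q ^ k
  scale k = Y ^ (M ∸ k) * qpoch (Q * Q ^ k) (M ∸ k) ^ (2 ℕ.+ e)
  clearedTerm k = numerator k * scale k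

  clearedDenominator : ∀ k → k ≤ M →
    Y ^ k * qpoch Q k ^ (2 ℕ.+ e) * scale k ≈ Y ^ M * qpoch Q M ^ (2 ℕ.+ e)
  clearedDenominator k k≤M = trans
    (solve 4 (λ a b c d → a :* b :* (c :* d) := (a :* c) :* (b :* d)) refl _ _ _ _)
    (*-cong (trans (sym (^-homo-* Y k (M ∸ k))) (^-congʳ Y k+[M∸k]≡M))
            (trans (sym (^-distrib-* (qpoch Q k) (qpoch (Q * Q ^ k) (M ∸ k)) (2 ℕ.+ e)))
                   (^-congˡ (2 ℕ.+ e) (trans (sym (qpoch-+ Q k (M ∸ k)))
                                             (reflexive (≡.cong (qpoch Q) k+[M∸k]≡M))))))
    where
    k+[M∸k]≡M : k ℕ.+ (M ∸ k) ≡ M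
    k+[M∸k]≡M = ℕ.m+[n∸m]≡n k≤M

  module _ (p : Carrier) (qp≈1 : q * p ≈ 1#) where
    open Relation.Binary.Reasoning.Setoid setoid
    open Vanishing R q p e using (term)
    open Sums R using (sum-cong<; sum-*ˡ)

    pᵉ⁺¹Y≈1 : p ^ suc e * Y ≈ 1#
    pᵉ⁺¹Y≈1 = trans (*-comm _ _) (trans (sym (^-distrib-* q p (suc e))) (trans (^-congˡ (suc e) qp≈1) (1^k≈1 (suc e))))

    -- `clearedTerm` makes sense in ℤ[q], whereas `term` uses an inverse of q. The Y^k released by
    -- `homogeneous` and the Y^(M-k) in `scale` combine to a power that does not depend on k.
    clearedTerm≈term : ∀ k → k ≤ M → clearedTerm k ≈ Y ^ M * term M k
    clearedTerm≈term k k≤M = begin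
      A * g * homogeneous 1# Y k * X * (Y ^ (M ∸ k) * F)
        ≈⟨ *-congʳ (*-congʳ (*-congˡ (homogeneous-qpoch pᵉ⁺¹Y≈1 k))) ⟩
      A * g * (Y ^ k * h) * X * (Y ^ (M ∸ k) * F)
        ≈⟨ solve 7 (λ A g P h X P′ F → A :* g :* (P :* h) :* X :* (P′ :* F)
             := (P :* P′) :* (A :* g :* h :* X :* F)) refl A g (Y ^ k) h X (Y ^ (M ∸ k)) F ⟩
      Y ^ k * Y ^ (M ∸ k) * term M k
        ≈⟨ *-congʳ (trans (sym (^-homo-* Y k (M ∸ k))) (^-congʳ Y (ℕ.m+[n∸m]≡n k≤M))) ⟩
      Y ^ M * term M k ∎
      where
      A g h X F : Carrier
      A = qpoch (q * Q) k ^ e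
      g = qpoch q k
      h = qpoch (p ^ suc e) k
      X = Q ^ k
      F = qpoch (Q * Q ^ k) (M ∸ k) ^ (2 ℕ.+ e)

    sum-vanishes : (q ^ suc M - 1#) * (q ^ suc M - 1#) ≈ 0# →
      sum (suc M) clearedTerm + sum (suc M) clearedTerm ≈ 0#
    sum-vanishes ε²≈0 = begin
      sum (suc M) clearedTerm + sum (suc M) clearedTerm
        ≈⟨ +-cong factored factored ⟩
      Y ^ M * sum (suc M) (term M) + Y ^ M * sum (suc M) (term M)
        ≈⟨ distribˡ _ _ _ ⟨
      Y ^ M * (sum (suc M) (term M) + sum (suc M) (term M))
        ≈⟨ *-congˡ (Vanishing.sum-term+sum-term≈0 R q p e r qp≈1 ε²≈0) ⟩
      Y ^ M * 0#
        ≈⟨ zeroʳ _ ⟩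
      0# ∎
      where
      factored : sum (suc M) clearedTerm ≈ Y ^ M * sum (suc M) (term M)
      factored = trans (sum-cong< (suc M) (λ k k<1+M → clearedTerm≈term k (ℕ.s≤s⁻¹ k<1+M))) (sum-*ˡ (suc M) _ _)

module ClearedSumDivisibility {c ℓ : Level} (R : CommutativeRing c ℓ) (q : CommutativeRing.Carrier R) (e r : ℕ) where
  open CommutativeRing R hiding (zero)
  open IntegerCoefficients R using (module Solver)
  open Solver using (solve; _:=_; _:+_; _:*_; _:-_; :-_; con)
  open Algebra.Properties.CommutativeSemiring.Exp commutativeSemiring
  open Sums R using (sum)
  open ClearedSum R q e r

  u w : Carrier
  u = q ^ suc M
  w = (u - 1#) * (u - 1#)

  open Quotient R w
  private
    module Q = CommutativeRing quotient
    module Exp/ = Algebra.Properties.CommutativeSemiring.Exp Q.commutativeSemiring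
    module Sums/ = Sums quotient
    module Cleared/ = ClearedSum quotient q e r
    module Pochhammer/ = Pochhammer quotient
    open Pochhammer R

  -- The inverse of q modulo (u - 1)^2: q q^M (2 - u) = u (2 - u) = 1 - (u - 1)^2.
  p : Carrier
  p = q ^ M * (1# + 1# - u)

  qp≈1 : q * p ≈ₘ 1#
  qp≈1 = (- 1#) by solve 2
    (λ q x → q :* (x :* (con (+ 1) :+ con (+ 1) :- q :* x))
      := con (+ 1) :+ (q :* x :- con (+ 1)) :* (q :* x :- con (+ 1)) :* (:- con (+ 1)))
    refl q (q ^ M)

  w≈0 : w ≈ₘ 0#
  w≈0 = 1# by solve 1 (λ w → w := con (+ 0) :+ w :* con (+ 1)) refl w

  Q≡ : Q ≡ Cleared/.Q
  Q≡ = ^-quotient q (2 ℕ.+ e)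

  qpoch≡ : ∀ x k → qpoch Q x k ≡ Pochhammer/.qpoch Cleared/.Q x k
  qpoch≡ x k = ≡.trans (qpoch-quotient Q x k) (≡.cong (λ Q → Pochhammer/.qpoch Q x k) Q≡)

  Q^≡ : ∀ k → Q ^ k ≡ Cleared/.Q Exp/.^ k
  Q^≡ k = ≡.trans (^-quotient Q k) (≡.cong (Exp/._^ k) Q≡)

  qpoch^≡ : ∀ {x x′} → x ≡ x′ → ∀ k l → qpoch Q x k ^ l ≡ Pochhammer/.qpoch Cleared/.Q x′ k Exp/.^ l
  qpoch^≡ {x} ≡.refl k l = ≡.trans (^-quotient _ l) (≡.cong (Exp/._^ l) (qpoch≡ x k))

  homogeneous≡ : ∀ k → homogeneous Q 1# Y k ≡ Pochhammer/.homogeneous Cleared/.Q 1# Cleared/.Y k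
  homogeneous≡ k = ≡.trans (homogeneous-quotient Q 1# Y k)
    (≡.cong₂ (λ Q Y → Pochhammer/.homogeneous Q 1# Y k) Q≡ (^-quotient q (suc e)))

  clearedTerm≡ : ∀ k → clearedTerm k ≡ Cleared/.clearedTerm k
  clearedTerm≡ k = ≡.cong₂ _*_
    (≡.cong₂ _*_ (≡.cong₂ _*_ (≡.cong₂ _*_ (qpoch^≡ (≡.cong (q *_) Q≡) k e) (qpoch≡ q k)) (homogeneous≡ k)) (Q^≡ k))
    (≡.cong₂ _*_ (≡.trans (^-quotient Y (M ∸ k)) (≡.cong (Exp/._^ (M ∸ k)) (^-quotient q (suc e))))
      (qpoch^≡ (≡.cong₂ _*_ Q≡ (Q^≡ k)) (M ∸ k) (2 ℕ.+ e)))

  sum≡ : ∀ n → sum n clearedTerm ≡ Sums/.sum n Cleared/.clearedTerm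
  sum≡ zero    = ≡.refl
  sum≡ (suc n) = ≡.cong₂ _+_ (sum≡ n) (clearedTerm≡ n)

  sum-divisible : ∃ λ H → sum (suc M) clearedTerm + sum (suc M) clearedTerm ≈ w * H
  sum-divisible = _≈ₘ_.factor vanishes , trans (reflexive (≡.cong₂ _+_ (sum≡ (suc M)) (sum≡ (suc M))))
    (trans (_≈ₘ_.eq vanishes) (+-identityˡ _))
    where
    ε²≈0 : (q Exp/.^ suc M - 1#) * (q Exp/.^ suc M - 1#) ≈ₘ 0#
    ε²≈0 = ≡.subst (λ u → (u - 1#) * (u - 1#) ≈ₘ 0#) (^-quotient q (suc M)) w≈0
    vanishes : Sums/.sum (suc M) Cleared/.clearedTerm + Sums/.sum (suc M) Cleared/.clearedTerm ≈ₘ 0#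
    vanishes = Cleared/.sum-vanishes p qp≈1 ε²≈0

-- The ring ℤ[q]

infix 4 _≋_
-- `_≈P_` unfolds to coefficient equations, from which the two polynomials are hard to infer; the
-- record keeps them visible to unification.
record _≋_ (p r : Poly) : Set where
  constructor wrap
  field coeff≡ : p ≈P r
open _≋_ public

-- Ring laws are proved on coefficient sequences, where trailing zeros make no difference. The
-- recursion strips the left factor from the front, exactly as `_*P_` does.
convolution : (ℕ → ℤ) → (ℕ → ℤ) → ℕ → ℤ
convolution f g zero    = f 0 ℤ.* g 0
convolution f g (suc i) = f 0 ℤ.* g (suc i) ℤ.+ convolution (f ∘ suc) g i

module PolynomialArithmetic where
  open ≡ using (refl; cong; cong₂; sym; trans)
  open ≡.≡-Reasoning
  open ℤ-Solver using (solve; _:=_; _:+_; _:*_; con)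

  _∗_ = convolution

  ∗-cong : ∀ {f f′ g g′} → (∀ i → f i ≡ f′ i) → (∀ i → g i ≡ g′ i) → ∀ i → (f ∗ g) i ≡ (f′ ∗ g′) i
  ∗-cong f≗ g≗ zero    = cong₂ ℤ._*_ (f≗ 0) (g≗ 0)
  ∗-cong f≗ g≗ (suc i) = cong₂ ℤ._+_ (cong₂ ℤ._*_ (f≗ 0) (g≗ (suc i))) (∗-cong (f≗ ∘ suc) g≗ i)

  ∗-zeroˡ : ∀ g i → ((λ _ → + 0) ∗ g) i ≡ + 0
  ∗-zeroˡ g zero    = refl
  ∗-zeroˡ g (suc i) = trans (ℤ.+-identityˡ _) (∗-zeroˡ g i)

  ∗-distribʳ : ∀ h f g i → ((λ j → f j ℤ.+ g j) ∗ h) i ≡ (f ∗ h) i ℤ.+ (g ∗ h) i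
  ∗-distribʳ h f g zero    = ℤ.*-distribʳ-+ (h 0) (f 0) (g 0)
  ∗-distribʳ h f g (suc i) = trans (cong (ℤ._+_ ((f 0 ℤ.+ g 0) ℤ.* h (suc i))) (∗-distribʳ h (f ∘ suc) (g ∘ suc) i))
    (solve 5 (λ a b x y z → (a :+ b) :* x :+ (y :+ z) := (a :* x :+ y) :+ (b :* x :+ z)) refl
      (f 0) (g 0) (h (suc i)) _ _)

  ∗-scaleˡ : ∀ a f g i → ((λ j → a ℤ.* f j) ∗ g) i ≡ a ℤ.* (f ∗ g) i
  ∗-scaleˡ a f g zero    = ℤ.*-assoc a (f 0) (g 0)
  ∗-scaleˡ a f g (suc i) = trans (cong (ℤ._+_ (a ℤ.* f 0 ℤ.* g (suc i))) (∗-scaleˡ a (f ∘ suc) g i))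
    (solve 4 (λ a b x y → a :* b :* x :+ a :* y := a :* (b :* x :+ y)) refl a (f 0) (g (suc i)) _)

  -- The mirror recursion, which strips the right factor; with it commutativity is a direct
  -- induction.
  ∗-sucʳ : ∀ f g i → (f ∗ g) (suc i) ≡ (f ∗ (g ∘ suc)) i ℤ.+ f (suc i) ℤ.* g 0
  ∗-sucʳ f g zero    = refl
  ∗-sucʳ f g (suc i) = trans (cong (ℤ._+_ (f 0 ℤ.* g (suc (suc i)))) (∗-sucʳ (f ∘ suc) g i))
    (sym (ℤ.+-assoc (f 0 ℤ.* g (suc (suc i))) _ _))

  ∗-comm : ∀ f g i → (f ∗ g) i ≡ (g ∗ f) i
  ∗-comm f g zero    = ℤ.*-comm (f 0) (g 0)
  ∗-comm f g (suc i) = begin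
    f 0 ℤ.* g (suc i) ℤ.+ ((f ∘ suc) ∗ g) i  ≡⟨ cong₂ ℤ._+_ (ℤ.*-comm (f 0) _) (∗-comm (f ∘ suc) g i) ⟩
    g (suc i) ℤ.* f 0 ℤ.+ (g ∗ (f ∘ suc)) i  ≡⟨ ℤ.+-comm (g (suc i) ℤ.* f 0) _ ⟩
    (g ∗ (f ∘ suc)) i ℤ.+ g (suc i) ℤ.* f 0  ≡⟨ ∗-sucʳ g f i ⟨
    (g ∗ f) (suc i)                          ∎

  ∗-assoc : ∀ f g h i → ((f ∗ g) ∗ h) i ≡ (f ∗ (g ∗ h)) i
  ∗-assoc f g h zero    = ℤ.*-assoc (f 0) (g 0) (h 0)
  ∗-assoc f g h (suc i) = begin
    f 0 ℤ.* g 0 ℤ.* h (suc i) ℤ.+ ((λ j → f 0 ℤ.* g (suc j) ℤ.+ ((f ∘ suc) ∗ g) j) ∗ h) i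
      ≡⟨ cong (ℤ._+_ (f 0 ℤ.* g 0 ℤ.* h (suc i))) (trans (∗-distribʳ h (λ j → f 0 ℤ.* g (suc j)) ((f ∘ suc) ∗ g) i)
           (cong₂ ℤ._+_ (∗-scaleˡ (f 0) (g ∘ suc) h i) (∗-assoc (f ∘ suc) g h i))) ⟩
    f 0 ℤ.* g 0 ℤ.* h (suc i) ℤ.+ (f 0 ℤ.* ((g ∘ suc) ∗ h) i ℤ.+ ((f ∘ suc) ∗ (g ∗ h)) i)
      ≡⟨ solve 5 (λ a b c x y → a :* b :* c :+ (a :* x :+ y) := a :* (b :* c :+ x) :+ y) refl
           (f 0) (g 0) (h (suc i)) _ _ ⟩
    (f ∗ (g ∗ h)) (suc i) ∎

  coeff-+P : ∀ p r i → coeff (p +P r) i ≡ coeff p i ℤ.+ coeff r i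
  coeff-+P []       r        i       = sym (ℤ.+-identityˡ _)
  coeff-+P (a ∷ as) []       i       = sym (ℤ.+-identityʳ _)
  coeff-+P (a ∷ as) (b ∷ bs) zero    = refl
  coeff-+P (a ∷ as) (b ∷ bs) (suc i) = coeff-+P as bs i

  coeff-scaleP : ∀ c p i → coeff (scaleP c p) i ≡ c ℤ.* coeff p i
  coeff-scaleP c []       i       = sym (ℤ.*-zeroʳ c)
  coeff-scaleP c (a ∷ as) zero    = refl
  coeff-scaleP c (a ∷ as) (suc i) = coeff-scaleP c as i

  coeff-negP : ∀ p i → coeff (negP p) i ≡ ℤ.- coeff p i
  coeff-negP p i = trans (coeff-scaleP (ℤ.- (+ 1)) p i) (ℤ.-1*i≡-i _)

  coeff-*P : ∀ p r i → coeff (p *P r) i ≡ (coeff p ∗ coeff r) i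
  coeff-*P []       r i       = sym (∗-zeroˡ (coeff r) i)
  coeff-*P (a ∷ as) r zero    = trans (coeff-+P (scaleP a r) _ 0)
    (trans (ℤ.+-identityʳ _) (coeff-scaleP a r 0))
  coeff-*P (a ∷ as) r (suc i) = trans (coeff-+P (scaleP a r) _ (suc i))
    (cong₂ ℤ._+_ (coeff-scaleP a r (suc i)) (coeff-*P as r i))

  coeff-constP-∗ : ∀ a g i → (coeff (constP a) ∗ g) i ≡ a ℤ.* g i
  coeff-constP-∗ a g zero    = refl
  coeff-constP-∗ a g (suc i) = trans (cong (ℤ._+_ (a ℤ.* g (suc i))) (∗-zeroˡ g i)) (ℤ.+-identityʳ _)

  *P-assoc : ∀ p r s → (p *P r) *P s ≋ p *P (r *P s)
  *P-assoc p r s = wrap λ i → begin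
    coeff ((p *P r) *P s) i                  ≡⟨ coeff-*P (p *P r) s i ⟩
    (coeff (p *P r) ∗ coeff s) i             ≡⟨ ∗-cong (coeff-*P p r) (λ _ → refl) i ⟩
    ((coeff p ∗ coeff r) ∗ coeff s) i        ≡⟨ ∗-assoc (coeff p) (coeff r) (coeff s) i ⟩
    (coeff p ∗ (coeff r ∗ coeff s)) i        ≡⟨ ∗-cong {f = coeff p} (λ _ → refl) (coeff-*P r s) i ⟨
    (coeff p ∗ coeff (r *P s)) i             ≡⟨ coeff-*P p (r *P s) i ⟨
    coeff (p *P (r *P s)) i                  ∎

  *P-comm : ∀ p r → p *P r ≋ r *P p
  *P-comm p r = wrap λ i → trans (coeff-*P p r i) (trans (∗-comm (coeff p) (coeff r) i) (sym (coeff-*P r p i)))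

  *P-identityˡ : ∀ p → constP (+ 1) *P p ≋ p
  *P-identityˡ p = wrap λ i →
    trans (coeff-*P (constP (+ 1)) p i) (trans (coeff-constP-∗ (+ 1) (coeff p) i) (ℤ.*-identityˡ _))

  *P-distribʳ : ∀ s p r → (p +P r) *P s ≋ (p *P s) +P (r *P s)
  *P-distribʳ s p r = wrap λ i → begin
    coeff ((p +P r) *P s) i                              ≡⟨ coeff-*P (p +P r) s i ⟩
    (coeff (p +P r) ∗ coeff s) i                         ≡⟨ ∗-cong (coeff-+P p r) (λ _ → refl) i ⟩
    ((λ j → coeff p j ℤ.+ coeff r j) ∗ coeff s) i        ≡⟨ ∗-distribʳ (coeff s) (coeff p) (coeff r) i ⟩
    (coeff p ∗ coeff s) i ℤ.+ (coeff r ∗ coeff s) i      ≡⟨ cong₂ ℤ._+_ (coeff-*P p s i) (coeff-*P r s i) ⟨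
    coeff (p *P s) i ℤ.+ coeff (r *P s) i                ≡⟨ coeff-+P (p *P s) (r *P s) i ⟨
    coeff ((p *P s) +P (r *P s)) i                       ∎

  *P-cong : ∀ {p p′ r r′} → p ≋ p′ → r ≋ r′ → p *P r ≋ p′ *P r′
  *P-cong {p} {p′} {r} {r′} p≋ r≋ = wrap λ i →
    trans (coeff-*P p r i) (trans (∗-cong (coeff≡ p≋) (coeff≡ r≋) i) (sym (coeff-*P p′ r′ i)))

  +P-cong : ∀ {p p′ r r′} → p ≋ p′ → r ≋ r′ → p +P r ≋ p′ +P r′
  +P-cong {p} {p′} {r} {r′} p≋ r≋ = wrap λ i →
    trans (coeff-+P p r i) (trans (cong₂ ℤ._+_ (coeff≡ p≋ i) (coeff≡ r≋ i)) (sym (coeff-+P p′ r′ i)))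

  +P-assoc : ∀ p r s → (p +P r) +P s ≋ p +P (r +P s)
  +P-assoc p r s = wrap λ i → begin
    coeff ((p +P r) +P s) i                        ≡⟨ coeff-+P (p +P r) s i ⟩
    coeff (p +P r) i ℤ.+ coeff s i                 ≡⟨ cong (ℤ._+ coeff s i) (coeff-+P p r i) ⟩
    coeff p i ℤ.+ coeff r i ℤ.+ coeff s i          ≡⟨ ℤ.+-assoc (coeff p i) _ _ ⟩
    coeff p i ℤ.+ (coeff r i ℤ.+ coeff s i)        ≡⟨ cong (ℤ._+_ (coeff p i)) (coeff-+P r s i) ⟨
    coeff p i ℤ.+ coeff (r +P s) i                 ≡⟨ coeff-+P p (r +P s) i ⟨
    coeff (p +P (r +P s)) i                        ∎

  +P-comm : ∀ p r → p +P r ≋ r +P p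
  +P-comm p r = wrap λ i → trans (coeff-+P p r i)
    (trans (ℤ.+-comm (coeff p i) _) (sym (coeff-+P r p i)))

  negP-inverseˡ : ∀ p → negP p +P p ≋ []
  negP-inverseˡ p = wrap λ i → trans (coeff-+P (negP p) p i)
    (trans (cong (ℤ._+ coeff p i) (coeff-negP p i)) (ℤ.+-inverseˡ (coeff p i)))

  negP-cong : ∀ {p r} → p ≋ r → negP p ≋ negP r
  negP-cong {p} {r} p≋r = wrap λ i → trans (coeff-negP p i)
    (trans (cong (ℤ.-_) (coeff≡ p≋r i)) (sym (coeff-negP r i)))

open PolynomialArithmetic

polyRing : CommutativeRing 0ℓ 0ℓ
polyRing = record
  { Carrier = Poly ; _≈_ = _≋_ ; _+_ = _+P_ ; _*_ = _*P_ ; -_ = negP ; 0# = [] ; 1# = constP (+ 1)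
  ; isCommutativeRing = record
    { isRing = record
      { +-isAbelianGroup = record
        { isGroup = record
          { isMonoid = record
            { isSemigroup = record
              { isMagma = record
                { isEquivalence = record
                  { refl  = wrap λ _ → ≡.refl
                  ; sym   = λ e → wrap λ i → ≡.sym (coeff≡ e i)
                  ; trans = ≋-trans }
                ; ∙-cong = +P-cong }
              ; assoc = +P-assoc }
            ; identity = (λ _ → wrap λ _ → ≡.refl) , (λ p → ≋-trans (+P-comm p []) (wrap λ _ → ≡.refl)) }
          ; inverse = negP-inverseˡ , (λ p → ≋-trans (+P-comm p (negP p)) (negP-inverseˡ p))
          ; ⁻¹-cong = negP-cong }
        ; comm = +P-comm }
      ; *-cong = *P-cong
      ; *-assoc = *P-assoc
      ; *-identity = *P-identityˡ , (λ p → ≋-trans (*P-comm p _) (*P-identityˡ p))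
      ; distrib = (λ s p r → ≋-trans (*P-comm s (p +P r))
                     (≋-trans (*P-distribʳ s p r) (+P-cong (*P-comm p s) (*P-comm r s))))
                , *P-distribʳ }
    ; *-comm = *P-comm } }
  where
  ≋-trans : ∀ {p r s} → p ≋ r → r ≋ s → p ≋ s
  ≋-trans e e′ = wrap λ i → ≡.trans (coeff≡ e i) (coeff≡ e′ i)

-- Fractions and coprimality

module FractionAlgebra {c ℓ : Level} (R : CommutativeRing c ℓ) where
  open CommutativeRing R hiding (zero)
  open Algebra.Properties.CommutativeSemiring.Exp commutativeSemiring
  open Relation.Binary.Reasoning.Setoid setoid
  open IntegerCoefficients R using (module Solver)
  open Solver using (solve; _:=_; _:+_; _:*_; _:-_; :-_; con)

  times : ∀ {n d x y n′ d′ x′ y′} → n * y ≈ x * d → n′ * y′ ≈ x′ * d′ →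
    (n * n′) * (y * y′) ≈ (x * x′) * (d * d′)
  times {n} {d} {x} {y} {n′} {d′} {x′} {y′} h h′ = trans (interchange n n′ y y′)
    (trans (*-cong h h′) (interchange x d x′ d′))
    where
    interchange : ∀ a b c d → (a * b) * (c * d) ≈ (a * c) * (b * d)
    interchange = solve 4 (λ a b c d → (a :* b) :* (c :* d) := (a :* c) :* (b :* d)) refl

  plus : ∀ {n d n′ d′ x x′ y} → n * y ≈ x * d → n′ * y ≈ x′ * d′ →
    (n * d′ + n′ * d) * y ≈ (x + x′) * (d * d′)
  plus {n} {d} {n′} {d′} {x} {x′} {y} h h′ = trans
    (solve 5 (λ n d n′ d′ y → (n :* d′ :+ n′ :* d) :* y := (n :* y) :* d′ :+ (n′ :* y) :* d) refl n d n′ d′ y)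
    (trans (+-cong (*-congʳ h) (*-congʳ h′))
      (solve 4 (λ d d′ x x′ → (x :* d) :* d′ :+ (x′ :* d′) :* d := (x :+ x′) :* (d :* d′)) refl d d′ x x′))

  negate : ∀ {n d x y} → n * y ≈ x * d → - n * y ≈ - x * d
  negate {n} {d} {x} {y} h = trans (solve 2 (λ n y → :- n :* y := :- (n :* y)) refl n y)
    (trans (-‿cong h) (solve 2 (λ x d → :- (x :* d) := :- x :* d) refl x d))

  expand : ∀ {n d x y} z → n * y ≈ x * d → n * (y * z) ≈ (x * z) * d
  expand {n} {d} {x} {y} z h = trans (sym (*-assoc n y z))
    (trans (*-congʳ h) (solve 3 (λ x d z → x :* d :* z := x :* z :* d) refl x d z))

  reduce : ∀ {n d x y} z → n * (y * z) ≈ (x * z) * d → (n * y) * z ≈ (x * d) * z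
  reduce {n} {d} {x} {y} z h = trans (*-assoc n y z)
    (trans h (solve 3 (λ x z d → x :* z :* d := x :* d :* z) refl x z d))

  -- The conclusion is the equation in `CongMod` written out for n/d = x/y against 0, with quotient
  -- N / (2y): the 2 of the doubled sum moves into the denominator.
  difference-zero : ∀ {n d x y P N} → n * y ≈ x * d → x + x ≈ P * N →
    (n * 1# + 0# * d) * (1# * ((1# + 1#) * y)) ≈ (P * N) * (d * 1#)
  difference-zero {n} {d} {x} {y} {P} {N} h h′ = trans
    (solve 3 (λ n d y → (n :* con (+ 1) :+ con (+ 0) :* d) :* (con (+ 1) :* ((con (+ 1) :+ con (+ 1)) :* y))
      := (n :* y :+ n :* y)) refl n d y)
    (trans (+-cong h h) (trans (solve 2 (λ x d → x :* d :+ x :* d := (x :+ x) :* (d :* con (+ 1))) refl x d)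
      (*-congʳ h′)))

  NonZeroDivisor : Carrier → Set _
  NonZeroDivisor z = ∀ {x y} → x * z ≈ y * z → x ≈ y

  nonZeroDivisor-1 : NonZeroDivisor 1#
  nonZeroDivisor-1 h = trans (sym (*-identityʳ _)) (trans h (*-identityʳ _))

  nonZeroDivisor-* : ∀ {z z′} → NonZeroDivisor z → NonZeroDivisor z′ → NonZeroDivisor (z * z′)
  nonZeroDivisor-* c c′ h = c (c′ (trans (*-assoc _ _ _) (trans h (sym (*-assoc _ _ _)))))

  nonZeroDivisor-^ : ∀ {z} → NonZeroDivisor z → ∀ k → NonZeroDivisor (z ^ k)
  nonZeroDivisor-^ c zero = nonZeroDivisor-1
  nonZeroDivisor-^ {z} c (suc k) = nonZeroDivisor-* {z} {z ^ k} c (nonZeroDivisor-^ c k)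

  nonZeroDivisor-cong : ∀ {z z′} → z ≈ z′ → NonZeroDivisor z → NonZeroDivisor z′
  nonZeroDivisor-cong z≈z′ c h = c (trans (*-congˡ z≈z′) (trans h (*-congˡ (sym z≈z′))))

  bezout-* : ∀ {D D′ P U V c U′ V′ c′} → U * D + V * P ≈ c → U′ * D′ + V′ * P ≈ c′ →
    (U * U′) * (D * D′) + (U * D * V′ + V * c′) * P ≈ c * c′
  bezout-* {D} {D′} {P} {U} {V} {c} {U′} {V′} {c′} h h′ = trans
    (+-congˡ (*-congʳ (+-congˡ (*-congˡ (sym h′)))))
    (trans (solve 7 (λ D D′ P U V U′ V′ →
        (U :* U′) :* (D :* D′) :+ (U :* D :* V′ :+ V :* (U′ :* D′ :+ V′ :* P)) :* P
        := (U :* D :+ V :* P) :* (U′ :* D′ :+ V′ :* P)) refl D D′ P U V U′ V′)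
      (*-cong h h′))

  bezout-sym : ∀ {D P U V c} → U * D + V * P ≈ c → V * P + U * D ≈ c
  bezout-sym h = trans (+-comm _ _) h

  -- If x (1 - t) = y (1 - t), then x - y is fixed by multiplication by t.
  nonZeroDivisor-1- : ∀ {t} → (∀ {f} → f ≈ t * f → f ≈ 0#) → NonZeroDivisor (1# - t)
  nonZeroDivisor-1- {t} fixed {x} {y} h = begin
    x            ≈⟨ solve 2 (λ x y → x := x :- y :+ y) refl x y ⟩
    x - y + y    ≈⟨ +-congʳ (fixed (begin
      x - y
        ≈⟨ solve 3 (λ x y t → x :- y := t :* (x :- y) :+ (x :* (con (+ 1) :- t) :- y :* (con (+ 1) :- t)))
             refl x y t ⟩
      t * (x - y) + (x * (1# - t) - y * (1# - t))
        ≈⟨ +-congˡ (trans (+-congʳ h) (-‿inverseʳ _)) ⟩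
      t * (x - y) + 0#
        ≈⟨ +-identityʳ _ ⟩
      t * (x - y) ∎)) ⟩
    0# + y       ≈⟨ +-identityˡ y ⟩
    y            ∎

  fixed-iterate : ∀ {f t s} → f ≈ t * s * f → ∀ k → f ≈ t ^ k * (s ^ k * f)
  fixed-iterate f≈tsf zero = sym (trans (*-identityˡ _) (*-identityˡ _))
  fixed-iterate {f} {t} {s} f≈tsf (suc k) = trans f≈tsf (trans (*-congˡ (fixed-iterate f≈tsf k))
    (solve 5 (λ t s x y f → t :* s :* (x :* (y :* f)) := t :* x :* (s :* y :* f)) refl t s (t ^ k) (s ^ k) f))

  bezout-1 : ∀ D P → 1# * D + 0# * P ≈ D
  bezout-1 = solve 2 (λ D P → con (+ 1) :* D :+ con (+ 0) :* P := D) refl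

  module GeometricSum (q : Carrier) (S : ℕ → Carrier) (S-zero : S 0 ≈ 0#)
                      (S-suc : ∀ n → S (suc n) ≈ 1# + q * S n) where

    geometric : ∀ n → (1# - q) * S n ≈ 1# - q ^ n
    geometric zero    = trans (*-congˡ S-zero) (solve 1 (λ q → (con (+ 1) :- q) :* con (+ 0) := con (+ 1) :- con (+ 1)) refl q)
    geometric (suc n) = begin
      (1# - q) * S (suc n)             ≈⟨ *-congˡ (S-suc n) ⟩
      (1# - q) * (1# + q * S n)        ≈⟨ solve 2 (λ q s → (con (+ 1) :- q) :* (con (+ 1) :+ q :* s)
                                            := (con (+ 1) :- q) :+ q :* ((con (+ 1) :- q) :* s)) refl q (S n) ⟩
      (1# - q) + q * ((1# - q) * S n)  ≈⟨ +-congˡ (*-congˡ (geometric n)) ⟩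
      (1# - q) + q * (1# - q ^ n)      ≈⟨ solve 2 (λ q x → (con (+ 1) :- q) :+ q :* (con (+ 1) :- x)
                                            := con (+ 1) :- q :* x) refl q (q ^ n) ⟩
      1# - q ^ suc n                   ∎

    geometric² : ∀ n H → (q ^ n - 1#) * (q ^ n - 1#) * H ≈ (S n * S n) * ((1# - q) * (1# - q) * H)
    geometric² n H = begin
      (q ^ n - 1#) * (q ^ n - 1#) * H
        ≈⟨ solve 2 (λ x H → (x :- con (+ 1)) :* (x :- con (+ 1)) :* H
             := (con (+ 1) :- x) :* (con (+ 1) :- x) :* H) refl (q ^ n) H ⟩
      (1# - q ^ n) * (1# - q ^ n) * H
        ≈⟨ *-congʳ (*-cong (geometric n) (geometric n)) ⟨
      (1# - q) * S n * ((1# - q) * S n) * H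
        ≈⟨ solve 3 (λ x s H → x :* s :* (x :* s) :* H := (s :* s) :* (x :* x :* H)) refl (1# - q) (S n) H ⟩
      (S n * S n) * ((1# - q) * (1# - q) * H) ∎

    bezout-q : ∀ n → - S n * q + 1# * S (suc n) ≈ 1#
    bezout-q n = trans (+-congˡ (*-congˡ (S-suc n)))
      (solve 2 (λ q s → :- s :* q :+ con (+ 1) :* (con (+ 1) :+ q :* s) := con (+ 1)) refl q (S n))

    -- For N the map ℕ → R this is (n − [n]) / (1 − q).
    cofactor : (ℕ → Carrier) → ℕ → Carrier
    cofactor N zero    = 0#
    cofactor N (suc n) = N n + q * cofactor N n

    -- Modulo 1 - q the q-integer [n] becomes n, so the Bézout constant is n itself.
    bezout-1-q : ∀ N → N 0 ≈ 0# → (∀ n → 1# + N n ≈ N (suc n)) →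
      ∀ n → cofactor N n * (1# - q) + 1# * S n ≈ N n
    bezout-1-q N N-zero N-suc zero = trans (+-congˡ (*-congˡ S-zero))
      (trans (solve 1 (λ q → con (+ 0) :* (con (+ 1) :- q) :+ con (+ 1) :* con (+ 0) := con (+ 0)) refl q) (sym N-zero))
    bezout-1-q N N-zero N-suc (suc n) = begin
      (N n + q * cofactor N n) * (1# - q) + 1# * S (suc n)
        ≈⟨ +-congˡ (*-congˡ (S-suc n)) ⟩
      (N n + q * cofactor N n) * (1# - q) + 1# * (1# + q * S n)
        ≈⟨ solve 4 (λ c q w s → (c :+ q :* w) :* (con (+ 1) :- q) :+ con (+ 1) :* (con (+ 1) :+ q :* s)
             := c :* (con (+ 1) :- q) :+ con (+ 1) :+ q :* (w :* (con (+ 1) :- q) :+ con (+ 1) :* s)) refl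
             (N n) q (cofactor N n) (S n) ⟩
      N n * (1# - q) + 1# + q * (cofactor N n * (1# - q) + 1# * S n)
        ≈⟨ +-congˡ (*-congˡ (bezout-1-q N N-zero N-suc n)) ⟩
      N n * (1# - q) + 1# + q * N n
        ≈⟨ solve 2 (λ c q → c :* (con (+ 1) :- q) :+ con (+ 1) :+ q :* c := con (+ 1) :+ c) refl (N n) q ⟩
      1# + N n
        ≈⟨ N-suc n ⟩
      N (suc n) ∎

-- Cancellation and coprimality in ℤ[q]

module PolynomialFacts where
  open CommutativeRing polyRing hiding (zero)
  open Algebra.Properties.CommutativeSemiring.Exp commutativeSemiring
  open FractionAlgebra polyRing
  open PolynomialArithmetic

  q : Poly
  q = monoP 1

  ∷≋q* : ∀ p → (+ 0 ∷ p) ≋ q * p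
  ∷≋q* p = wrap λ where
      zero    → ≡.sym (≡.trans (coeff-*P q p 0) (ℤ.*-zeroˡ (coeff p 0)))
      (suc i) → ≡.sym (≡.trans (coeff-*P q p (suc i)) (≡.trans (ℤ.+-identityˡ _)
        (≡.trans (coeff-constP-∗ (+ 1) (coeff p) i) (ℤ.*-identityˡ _))))

  ∷≋constP+q* : ∀ a p → (a ∷ p) ≋ constP a + q * p
  ∷≋constP+q* a p = trans {a ∷ p} {constP a + (+ 0 ∷ p)} {constP a + q * p}
    (wrap λ where
      zero    → ≡.sym (ℤ.+-identityʳ a)
      (suc i) → ≡.refl)
    (+-congˡ {constP a} {+ 0 ∷ p} {q * p} (∷≋q* p))

  monoP≋^ : ∀ k → monoP k ≋ q ^ k
  monoP≋^ zero    = refl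
  monoP≋^ (suc k) = trans (∷≋q* (monoP k)) (*-congˡ {q} (monoP≋^ k))

  qInt-suc : ∀ n → qInt (suc n) ≋ 1# + q * qInt n
  qInt-suc n = ∷≋constP+q* (+ 1) (qInt n)

  open GeometricSum q qInt refl qInt-suc public

  coeff-q^* : ∀ k p i → i < k → coeff (q ^ k * p) i ≡ + 0
  coeff-q^* (suc k) p i i<1+k = ≡.trans (coeff≡ (trans (*-assoc q (q ^ k) p) (sym (∷≋q* (q ^ k * p)))) i) (go i i<1+k)
    where
    go : ∀ i → i < suc k → coeff (+ 0 ∷ (q ^ k * p)) i ≡ + 0
    go zero    _         = ≡.refl
    go (suc i) (s≤s i<k) = coeff-q^* k p i i<k

  -- Iterating the equation i + 1 times shows f to be a multiple of q^(i+1), so its i-th coefficient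
  -- is zero.
  divisible-by-all-powers : ∀ {s f} → f ≋ q * s * f → f ≋ 0#
  divisible-by-all-powers {s} {f} f≋qsf = wrap λ i →
    ≡.trans (coeff≡ (fixed-iterate {f} {q} {s} f≋qsf (suc i)) i) (coeff-q^* (suc i) (s ^ suc i * f) i ℕ.≤-refl)

  nonZeroDivisor-1-q* : ∀ s → NonZeroDivisor (1# - q * s)
  nonZeroDivisor-1-q* s = nonZeroDivisor-1- {q * s} (divisible-by-all-powers {s})

  constP-* : ∀ a b → constP a * constP b ≋ constP (a ℤ.* b)
  constP-* a b = wrap λ where
    zero    → ℤ.+-identityʳ _
    (suc i) → ≡.refl

  Coprime-* : ∀ {D D′ P} → Coprime D P → Coprime D′ P → Coprime (D * D′) P
  Coprime-* {D} {D′} {P} (U , V , c , c≢0 , h) (U′ , V′ , c′ , c′≢0 , h′) =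
    U * U′ , U * D * V′ + V * constP c′ , c ℤ.* c′ , cc′≢0 ,
    coeff≡ (trans (bezout-* {D} {D′} {P} {U} {V} {constP c} {U′} {V′} {constP c′} (wrap h) (wrap h′)) (constP-* c c′))
    where
    cc′≢0 : c ℤ.* c′ ≢ + 0
    cc′≢0 cc′≡0 with ℤ.i*j≡0⇒i≡0∨j≡0 c cc′≡0
    ... | inj₁ c≡0  = c≢0 c≡0
    ... | inj₂ c′≡0 = c′≢0 c′≡0

  Coprime-sym : ∀ {D P} → Coprime D P → Coprime P D
  Coprime-sym {D} {P} (U , V , c , c≢0 , h) =
    V , U , c , c≢0 , coeff≡ (bezout-sym {D} {P} {U} {V} {constP c} (wrap h))

  Coprime-1 : ∀ P → Coprime 1# P
  Coprime-1 P = 1# , 0# , + 1 , (λ ()) , coeff≡ (bezout-1 1# P)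

  Coprime-^ : ∀ {D P} k → Coprime D P → Coprime (D ^ k) P
  Coprime-^ {P = P} zero    c = Coprime-1 P
  Coprime-^ {D} {P} (suc k) c = Coprime-* {D} {D ^ k} {P} c (Coprime-^ {D} {P} k c)

  Coprime-2 : ∀ P → Coprime (1# + 1#) P
  Coprime-2 P = 1# , 0# , + 2 , (λ ()) , coeff≡ (bezout-1 (1# + 1#) P)

  Coprime-q-qInt : ∀ n → Coprime q (qInt (suc n))
  Coprime-q-qInt n = - qInt n , 1# , + 1 , (λ ()) , coeff≡ (bezout-q n)

  Coprime-1-q-qInt : ∀ n → Coprime (1# - q) (qInt (suc n))
  Coprime-1-q-qInt n = cofactor (constP ∘ +_) (suc n) , 1# , + suc n , (λ ()) , coeff≡
    (bezout-1-q (constP ∘ +_) constP-0 (λ n → refl) (suc n))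
    where
    constP-0 : constP (+ 0) ≋ 0#
    constP-0 = wrap λ where
      zero    → ≡.refl
      (suc i) → ≡.refl

-- Fractions of the statement in chosen form

-- Says f = x/y by cross-multiplication. Operations on `Frac` never reduce, so the literal
-- denominators pile up; x/y is a form kept small by hand.
record Represents (f : Frac) (x y : Poly) : Set where
  constructor represents
  field cross : num f *P y ≋ x *P den f
open Represents

module Representation where
  open CommutativeRing polyRing hiding (zero)
  open Algebra.Properties.CommutativeSemiring.Exp commutativeSemiring
  open FractionAlgebra polyRing
  open Sums polyRing using (sum)

  rep-cong : ∀ {f x x′ y y′} → x ≋ x′ → y ≋ y′ → Represents f x y → Represents f x′ y′
  rep-cong {f} x≋x′ y≋y′ (represents h) = represents
    (trans (*-congˡ {num f} (sym y≋y′)) (trans h (*-congʳ {den f} x≋x′)))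

  rep-poly : ∀ p → Represents (poly p) p 1#
  rep-poly p = represents refl

  rep-zero : ∀ y → Represents zeroF 0# y
  rep-zero y = represents (trans (zeroˡ y) (sym (zeroˡ 1#)))

  rep-one : ∀ y → Represents oneF y y
  rep-one y = represents (*-comm 1# y)

  rep-* : ∀ {f g x y x′ y′} → Represents f x y → Represents g x′ y′ → Represents (f *F g) (x * x′) (y * y′)
  rep-* {f} {g} {x} {y} {x′} {y′} (represents h) (represents h′) =
    represents (times {num f} {den f} {x} {y} {num g} {den g} {x′} {y′} h h′)

  rep-/ : ∀ {f g x y x′ y′} → Represents f x y → Represents g x′ y′ → Represents (f /F g) (x * y′) (y * x′)
  rep-/ {f} {g} {x} {y} {x′} {y′} (represents h) (represents h′) =
    represents (times {num f} {den f} {x} {y} {den g} {num g} {y′} {x′} h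
      (trans (*-comm (den g) x′) (trans (sym h′) (*-comm (num g) y′))))

  rep-+ : ∀ {f g x x′ y} → Represents f x y → Represents g x′ y → Represents (f +F g) (x + x′) y
  rep-+ {f} {g} {x} {x′} {y} (represents h) (represents h′) =
    represents (plus {num f} {den f} {num g} {den g} {x} {x′} {y} h h′)

  rep-1- : ∀ {f x y} → Represents f x y → Represents (oneF -F f) (y - x) y
  rep-1- {f} {x} {y} (represents h) =
    rep-+ { oneF } { -F f } (rep-one y) (represents (negate {num f} {den f} {x} {y} h))

  rep-expand : ∀ {f x y} z → Represents f x y → Represents f (x * z) (y * z)
  rep-expand {f} {x} {y} z (represents h) = represents (expand {num f} {den f} {x} {y} z h)

  rep-reduce : ∀ {f x y z} → NonZeroDivisor z → Represents f (x * z) (y * z) → Represents f x y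
  rep-reduce {f} {x} {y} {z} c (represents h) =
    represents (c {num f * y} {x * den f} (reduce {num f} {den f} {x} {y} z h))

  rep-^ : ∀ {f x y} → Represents f x y → ∀ k → Represents (f ^F k) (x ^ k) (y ^ k)
  rep-^ h zero = rep-one 1#
  rep-^ {f} {x} {y} h (suc k) = rep-cong {f ^F suc k} (*-comm (x ^ k) x) (*-comm (y ^ k) y) (rep-* {f ^F k} {f} (rep-^ h k) h)

  -- One common denominator y serves all terms; the literal denominator of `sumF` is the product of
  -- all of theirs.
  rep-sum : ∀ n {f x y} → (∀ k → k < n → Represents (f k) (x k) y) → Represents (sumF n f) (sum n x) y
  rep-sum zero    {y = y} h = rep-zero y
  rep-sum (suc n) {f} h = rep-+ {sumF n f} {f n} (rep-sum n (λ k k<n → h k (ℕ.m<n⇒m<1+n k<n))) (h n ℕ.≤-refl)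

  module _ (Q : Poly) where
    open Pochhammer polyRing Q

    rep-poch : ∀ {f b X Y} → Represents f X Y → Represents b Q 1# → ∀ k →
      Represents (poch f b k) (homogeneous X Y k) (Y ^ k)
    rep-poch hf hb zero = rep-one 1#
    rep-poch {f} {b} {X} {Y} hf hb (suc k) =
      rep-cong {poch f b (suc k)} (refl {homogeneous X Y (suc k)}) (*-comm (Y ^ k) Y)
        (rep-* {poch f b k} {oneF -F f *F b ^F k} (rep-poch hf hb k)
          (rep-1- {f *F b ^F k} (rep-cong {f *F b ^F k} (refl {X * Q ^ k})
            (trans (*-congˡ {Y} (1^k≈1 k)) (*-identityʳ Y)) (rep-* {f} {b ^F k} hf (rep-^ hb k)))))

    rep-poch-poly : ∀ {f b X} → Represents f X 1# → Represents b Q 1# → ∀ k →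
      Represents (poch f b k) (qpoch X k) 1#
    rep-poch-poly {f} {b} {X} hf hb k =
      rep-cong {poch f b k} (homogeneous-1 X k) (1^k≈1 k) (rep-poch hf hb k)

-- q stays a variable, later monoP 1, to keep polynomial products from unfolding.
module LhsRepresentation (q : Poly) (e r : ℕ) where
  open CommutativeRing polyRing hiding (zero)
  open Algebra.Properties.CommutativeSemiring.Exp commutativeSemiring
  open FractionAlgebra polyRing
  open Sums polyRing using (sum)
  open ClearedSum polyRing q e r
  open Pochhammer polyRing Q
  open Representation

  d : ℕ
  d = 2 ℕ.+ e

  module _ (monoP≋^ : ∀ k → monoP k ≋ q ^ k)
           (nonZeroDivisor-1-q* : ∀ s → NonZeroDivisor (1# - q * s)) where

    rep-qPow : ∀ {x} k → q ^ k ≋ x → Represents (qPow (+ k)) x 1#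
    rep-qPow k qᵏ≋x = rep-cong {qPow (+ k)} (trans (monoP≋^ k) qᵏ≋x) (refl {1#}) (rep-poly (monoP k))

    rep-Q : Represents (qPow (+ d)) Q 1#
    rep-Q = rep-qPow d refl

    rep-q : Represents qF q 1#
    rep-q = rep-qPow 1 (*-identityʳ q)

    rep-qQ : Represents (qPow (+ (d ℕ.+ 1))) (q * Q) 1#
    rep-qQ = rep-qPow (d ℕ.+ 1) (^-congʳ q (ℕ.+-comm d 1))

    -- `+ 1 ℤ.- + d` computes to `-[1+ e ]`, so `qPow` takes its reciprocal branch with exponent d -
    -- 1.
    rep-1/Y : Represents (qPow (+ 1 ℤ.- + d)) 1# Y
    rep-1/Y = rep-cong {oneF /F poly (monoP (suc e))} (*-identityˡ 1#)
      (trans (*-identityˡ (monoP (suc e))) (monoP≋^ (suc e)))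
      (rep-/ {oneF} {poly (monoP (suc e))} (rep-one 1#) (rep-poly (monoP (suc e))))

    rep-numerator : ∀ k → Represents
      (poch (qPow (+ (d ℕ.+ 1))) (qPow (+ d)) k ^F e *F poch qF (qPow (+ d)) k
        *F poch (qPow (+ 1 ℤ.- + d)) (qPow (+ d)) k *F qPow (+ (d ℕ.* k)))
      (numerator k) (Y ^ k)
    rep-numerator k = rep-cong {f₁ *F f₂ *F f₃ *F f₄} (refl {numerator k})
      (trans (*-identityʳ (1# ^ e * 1# * Y ^ k))
        (trans (*-congʳ {Y ^ k} (trans (*-identityʳ (1# ^ e)) (1^k≈1 e))) (*-identityˡ (Y ^ k))))
      (rep-* {f₁ *F f₂ *F f₃} {f₄} (rep-* {f₁ *F f₂} {f₃} (rep-* {f₁} {f₂}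
        (rep-^ {poch (qPow (+ (d ℕ.+ 1))) (qPow (+ d)) k} (rep-poch-poly Q rep-qQ rep-Q k) e)
        (rep-poch-poly Q rep-q rep-Q k))
        (rep-poch Q rep-1/Y rep-Q k))
        (rep-qPow (d ℕ.* k) (sym (^-assocʳ q d k))))
      where
      f₁ f₂ f₃ f₄ : Frac
      f₁ = poch (qPow (+ (d ℕ.+ 1))) (qPow (+ d)) k ^F e
      f₂ = poch qF (qPow (+ d)) k
      f₃ = poch (qPow (+ 1 ℤ.- + d)) (qPow (+ d)) k
      f₄ = qPow (+ (d ℕ.* k))

    rep-denominator : ∀ k → Represents (poch (qPow (+ d)) (qPow (+ d)) k ^F d) (qpoch Q k ^ d) 1#
    rep-denominator k = rep-cong {poch (qPow (+ d)) (qPow (+ d)) k ^F d} (refl {qpoch Q k ^ d}) (1^k≈1 d)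
      (rep-^ {poch (qPow (+ d)) (qPow (+ d)) k} (rep-poch-poly Q rep-Q rep-Q k) d)

    rep-summand : ∀ k → k ≤ M → Represents (summand d k) (clearedTerm k) (Y ^ M * qpoch Q M ^ d)
    rep-summand k k≤M = rep-cong {summand d k}
      (*-congʳ {scale k} (*-identityʳ (numerator k))) (clearedDenominator k k≤M)
      (rep-expand {summand d k} (scale k) (rep-/ {_} {poch (qPow (+ d)) (qPow (+ d)) k ^F d} (rep-numerator k) (rep-denominator k)))

    S V Z : Poly
    S = sum (suc M) clearedTerm
    V = (1# - q) ^ (d ℕ.* suc M ∸ d)
    Z = qpoch Q M ^ d

    rep-prefactor : Represents (poch (qPow (+ d)) (qPow (+ d)) M ^F d /F (oneF -F qF) ^F (d ℕ.* suc M ∸ d)) Z V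
    rep-prefactor = rep-cong {poch (qPow (+ d)) (qPow (+ d)) M ^F d /F (oneF -F qF) ^F L}
      (trans (*-congˡ {Z} (1^k≈1 L)) (*-identityʳ Z)) (*-identityˡ V)
      (rep-/ {poch (qPow (+ d)) (qPow (+ d)) M ^F d} {(oneF -F qF) ^F L}
        (rep-denominator M) (rep-^ {oneF -F qF} (rep-1- {qF} rep-q) L))
      where
      L = d ℕ.* suc M ∸ d

    -- Every factor 1 - Q Q^k has the form 1 - q s, with s = Y Q^k.
    nonZeroDivisor-Z : NonZeroDivisor Z
    nonZeroDivisor-Z = nonZeroDivisor-^ {qpoch Q M} (go M) d
      where
      go : ∀ k → NonZeroDivisor (qpoch Q k)
      go zero    = nonZeroDivisor-1
      go (suc k) = nonZeroDivisor-* {qpoch Q k} {1# - Q * Q ^ k} (go k)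
        (nonZeroDivisor-cong {1# - q * (Y * Q ^ k)} {1# - Q * Q ^ k}
          (+-congˡ {1#} (-‿cong (sym (*-assoc q Y (Q ^ k))))) (nonZeroDivisor-1-q* (Y * Q ^ k)))

    -- The prefactor Z / V cancels the Z in the common denominator Y^M Z of the sum. What remains
    -- below is a product of powers of 1 - q and q, hence coprime to [n].
    rep-lhs : Represents (lhs d (suc M)) S (V * Y ^ M)
    rep-lhs = rep-reduce {lhs d (suc M)} {S} {V * Y ^ M} {Z} nonZeroDivisor-Z
      (rep-cong {lhs d (suc M)} (*-comm Z S) (sym (*-assoc V (Y ^ M) Z))
        (rep-* {_} {sumF (suc M) (summand d)} rep-prefactor
          (rep-sum (suc M) (λ k k<1+M → rep-summand k (ℕ.s≤s⁻¹ k<1+M)))))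

-- The congruence modulo [n]²

module LhsCongruence where
  open CommutativeRing polyRing hiding (zero)
  open Algebra.Properties.CommutativeSemiring.Exp commutativeSemiring
  open FractionAlgebra polyRing
  open PolynomialFacts

  represents⇒congMod : ∀ {f x y P N} → Represents f x y → x + x ≋ P * N →
    Coprime ((1# + 1#) * y) P → CongMod f zeroF P
  represents⇒congMod {f} {x} {y} {P} {N} (represents h) 2x≋PN coprime =
    N , (1# + 1#) * y , coprime , coeff≡ (difference-zero {num f} {den f} {x} {y} {P} {N} h 2x≋PN)

  Coprime-squareʳ : ∀ {D P} → Coprime D P → Coprime D (P * P)
  Coprime-squareʳ {D} {P} c = Coprime-sym {P * P} {D} (Coprime-* {P} {P} {D} (Coprime-sym {D} {P} c) (Coprime-sym {D} {P} c))

  lhs≡0 : ∀ e r → let n = suc (ClearedSum.M polyRing q e r) in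
    CongMod (lhs (2 ℕ.+ e) n) zeroF (qInt n *P qInt n)
  lhs≡0 e r = represents⇒congMod {lhs (2 ℕ.+ e) n}
    (LhsRepresentation.rep-lhs q e r monoP≋^ nonZeroDivisor-1-q*)
    (trans (proj₂ divisible) (geometric² n (proj₁ divisible)))
    -- The three kinds of factor in the denominator: 2 is a nonzero constant, 1 - q has Bézout
    -- constant n, and q has Bézout constant 1.
    (Coprime-squareʳ {(1# + 1#) * ((1# - q) ^ L * (q ^ suc e) ^ M)} {qInt n}
      (Coprime-* {1# + 1#} {(1# - q) ^ L * (q ^ suc e) ^ M} {qInt n} (Coprime-2 (qInt n))
        (Coprime-* {(1# - q) ^ L} {(q ^ suc e) ^ M} {qInt n}
          (Coprime-^ {1# - q} {qInt n} L (Coprime-1-q-qInt M))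
          (Coprime-^ {q ^ suc e} {qInt n} M (Coprime-^ {q} {qInt n} (suc e) (Coprime-q-qInt M))))))
    where
    M n L : ℕ
    M = ClearedSum.M polyRing q e r
    n = suc M
    L = (2 ℕ.+ e) ℕ.* n ∸ (2 ℕ.+ e)
    divisible = ClearedSumDivisibility.sum-divisible polyRing q e r

open import Data.Nat using (_*_)

theorem1p3 : (d n : ℕ) → 2 ≤ d → d ∣ suc n → 2 * d ∸ 1 ≤ n →
    CongMod (lhs d n) zeroF (qInt n *P qInt n)
theorem1p3 (suc (suc e)) n (s≤s (s≤s z≤n)) (divides zero ()) 2d-1≤n
-- Here n = d - 1, which is below 2d - 1. The remaining clause has m = 2 + r.
theorem1p3 (suc (suc e)) n (s≤s (s≤s z≤n)) (divides (suc zero) ≡.refl) 2d-1≤n =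
  ⊥-elim (ℕ.m+1+n≰m (suc e) (≡.subst (suc e ℕ.+ suc (suc (e ℕ.+ 0)) ≤_) (ℕ.+-identityʳ (suc e)) 2d-1≤n))
theorem1p3 (suc (suc e)) n (s≤s (s≤s z≤n)) (divides (suc (suc r)) 1+n≡md) 2d-1≤n =
  ≡.subst (λ n → CongMod (lhs (2 ℕ.+ e) n) zeroF (qInt n *P qInt n)) (≡.sym n≡1+M) (LhsCongruence.lhs≡0 e r)
  where
  open +-*-Solver
  n≡1+M : n ≡ suc (r ℕ.+ (2 ℕ.+ r) ℕ.+ e ℕ.* (2 ℕ.+ r))
  n≡1+M = ℕ.suc-injective (≡.trans 1+n≡md
    (solve 2 (λ e r → (con 2 :+ r) :* (con 2 :+ e)
      := con 2 :+ (r :+ (con 2 :+ r) :+ e :* (con 2 :+ r))) ≡.refl e r))
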